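{- In the combinatorial Marker-Cutter game with initial counter $g_0$, restricted Cutter has a strategy ensuring that the game reaches a game state of value at least $\frac43 g_0+2$.
   Context: A set of boundary cycles is a pair $(D,\chi)$: $D$ a finite directed graph each of whose components is a directed cycle (loops allowed, no isolated vertices), $\chi:E(D)\to L$ an edge labelling; proper if each label is used on at most two edges. A game state is $\gamma=(D,\chi,g)$ with $(D,\chi)$ proper, $g\in\mathbb N_0$; its value $v(\gamma)$ is the number of distinct labels used. Combinatorial Marker-Cutter game: start with $D_0$ empty, $\chi_0$ empty and counter $g_0\in\mathbb N$. At turn $k$ with state $(D_k,\chi_k,g_k)$, Marker chooses $v,w$ (not necessarily distinct) from $V(D_k)\sqcup\{v_\gamma,w_\gamma\}$ (dummy vertices; each chosen dummy vertex, without multiplicity, is added as a new vertex). Let $C,C'$ be the components containing $v,w$. Splitting a vertex $u$ replaces it by a source $u_1$ (incident to the out-edge) and a sink $u_2$ (incident to the in-edge). If $C=C'$: splitting turns $C$ into a directed path $P$ from $v_1$ to $w_2$ and a directed path $P'$ from $w_1$ to $v_2$ (trivial paths with $v_1=w_2$, $v_2=w_1$ if $v=w$ is dummy); new edges $f=\overrightarrow{w_2v_1}$, $f'=\overrightarrow{v_2w_1}$; $\hat C_1=P\cup\{f\}$, $\hat C_2=P'\cup\{f'\}$. Cutter chooses (a) $D_{k+1}=\bar D\cup\hat C_1\cup\hat C_2$, $g_{k+1}=g_k-1$ (only if $g_k\ge1$); (b) $D_{k+1}=\bar D\cup\hat C_1$, $g_{k+1}=\bar g$; (c) $D_{k+1}=\bar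 D\cup\hat C_2$, $g_{k+1}=\bar g$; with $\bar D$ a union of components of $D_k\setminus C$, $0\le\bar g\le g_k$. If $C\ne C'$: splitting turns $C$ into a path $P$ from $v_1$ to $v_2$ (trivial if $v$ dummy) and $C'$ into $P'$ from $w_1$ to $w_2$; the only move (d) is $D_{k+1}=(D_k\cup\hat C)\setminus(C\cup C')$ with $\hat C=P\cup P'\cup\{\overrightarrow{w_2v_1},\overrightarrow{v_2w_1}\}$, $g_{k+1}=g_k$. In all cases old labels are kept and the new edges receive one common new label not previously used. A contraction contracts one edge (deleting resulting isolated vertices). $(D',\chi',g')$ is a reduction of $(D,\chi,g)$ if $g'\le g$, $D'$ is obtained from $D$ by contractions and $\chi'=\chi$ on $E(D')$. Game states are equivalent if they are isomorphic as labelled digraphs up to a bijective relabelling and have equal counters. Restricted Cutter may never make a move producing a game state equivalent to a reduction of an earlier game state (including the current one), and in moves (a), (b), (c) must take $\bar D=D_k\setminus C$ and $\bar g=g_k$; if restricted Cutter has no legal move, the game ends. -}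

module Defs where

open import Data.Nat using (ℕ; zero; suc; _≤_; _∸_; _*_; _+_)
import Data.Nat as ℕ
open import Data.Fin using (Fin; _≟_)
open import Data.Fin.Permutation using (Permutation; Permutation′; _⟨$⟩ʳ_)
import Data.Fin.Permutation as Perm
open import Data.List using (List; []; _∷_; length; map; deduplicate; allFin)
open import Data.List.Membership.Propositional using (_∈_)
open import Data.Maybe using (Maybe; just; nothing)
open import Data.Sum using (_⊎_; inj₁; inj₂)
open import Data.Product using (Σ; ∃; ∃-syntax; _×_; _,_)
open import Data.Unit using (⊤)
open import Data.Empty using (⊥)
open import Relation.Nullary using (¬_; yes; no)
open import Relation.Binary.PropositionalEquality using (_≡_; _≢_)
open import Relation.Binary.Construct.Closure.ReflexiveTransitive using (Star)
open import Function using (_⇔_)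

-- Encoding of a set of boundary cycles (D, χ).
--
-- A finite digraph each of whose components is a directed cycle (loops
-- allowed, no isolated vertices) is encoded by its edge set  Fin m  together
-- with the successor permutation σ : the edge following edge e along its
-- cycle is σ e.  Vertex  i : Fin m  is the head of edge i (= the tail of
-- edge σ i); so vertices are also indexed by Fin m, the in-edge of vertex i
-- is i and its out-edge is σ i.  Components = cycles of σ, loops = fixed
-- points of σ.  Labels (the set L) are natural numbers.

iter : {A : Set} → (A → A) → ℕ → A → A
iter f zero    x = x
iter f (suc k) x = f (iter f k x)

OnCycle : {A : Set} → (A → A) → A → A → Set
OnCycle f e₀ e = ∃[ k ] iter f k e₀ ≡ e

record BCS : Set where
  field
    m      : ℕ
    σ      : Permutation′ m
    χ      : Fin m → ℕ
    proper : ∀ e₁ e₂ e₃ → χ e₁ ≡ χ e₂ → χ e₂ ≡ χ e₃ →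
             (e₁ ≡ e₂) ⊎ (e₂ ≡ e₃) ⊎ (e₁ ≡ e₃)

open BCS public

nxt : (D : BCS) → Fin (m D) → Fin (m D)
nxt D e = σ D ⟨$⟩ʳ e

record GameState : Set where
  field
    D : BCS
    g : ℕ

open GameState public

value : GameState → ℕ
value γ = length (deduplicate ℕ._≟_ (map (χ (D γ)) (allFin (m (D γ)))))

-- Equivalence: isomorphic as labelled digraphs up to a bijective
-- relabelling (label equality is preserved and reflected), equal counters.

Equiv : GameState → GameState → Set
Equiv γ δ =
  (g γ ≡ g δ) ×
  Σ (Permutation (m (D γ)) (m (D δ))) λ h →
    (∀ x → h ⟨$⟩ʳ (nxt (D γ) x) ≡ nxt (D δ) (h ⟨$⟩ʳ x)) ×
    (∀ x y → (χ (D γ) x ≡ χ (D γ) y) ⇔ (χ (D δ) (h ⟨$⟩ʳ x) ≡ χ (D δ) (h ⟨$⟩ʳ y)))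

-- Contraction of one edge e (a loop simply disappears together with its
-- then isolated vertex; otherwise the two end vertices of e are merged, so
-- the predecessor of e is followed by the successor of e).
-- Contraction D D' : D' is (a copy of) D with edge e contracted; the
-- injection h identifies the edges of D' with the edges of D other than e,
-- and labels are kept.

Contraction : BCS → BCS → Set
Contraction D D' =
  Σ (Fin (m D') → Fin (m D)) λ h →
  Σ (Fin (m D)) λ e →
    (∀ x y → h x ≡ h y → x ≡ y) ×
    (∀ x → h x ≢ e) ×
    (∀ y → y ≢ e → ∃[ x ] h x ≡ y) ×
    (∀ x → nxt D (h x) ≡ e → h (nxt D' x) ≡ nxt D (nxt D (h x))) ×
    (∀ x → nxt D (h x) ≢ e → h (nxt D' x) ≡ nxt D (h x)) ×
    (∀ x → χ D' x ≡ χ D (h x))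

IsReduction : GameState → GameState → Set
IsReduction r γ = Star Contraction (D γ) (D r) × (g r ≤ g γ)

Forbidden : List GameState → GameState → Set
Forbidden hist γ' = ∃[ γ ] (γ ∈ hist) × ∃[ r ] IsReduction r γ × Equiv γ' r

-- Marker's choices: vertices of D or one of the dummy vertices vγ, wγ.

data Pt (n : ℕ) : Set where
  real : Fin n → Pt n
  vγ   : Pt n
  wγ   : Pt n

SameComp : (D : BCS) → Pt (m D) → Pt (m D) → Set
SameComp D (real i) (real j) = ∃[ k ] iter (nxt D) k i ≡ j
SameComp D vγ vγ = ⊤
SameComp D wγ wγ = ⊤
SameComp D _ _ = ⊥

-- the two new edges f = w₂→v₁ and f' = v₂→w₁
data NewEdge : Set where
  𝒇 𝒇′ : NewEdge

E⁺ : ℕ → Set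
E⁺ n = Fin n ⊎ NewEdge

-- Successor of an old edge after splitting v, w and adding f, f'.
-- The in-edge of v is followed by f', the in-edge of w by f.
-- (If v = w is a real vertex we take the convention that P' is the whole
-- cycle and P is trivial: the in-edge of v is followed by f' and f is a
-- loop; the other convention gives the same game up to swapping (b)/(c).)
stepW : (D : BCS) → Pt (m D) → Fin (m D) → E⁺ (m D)
stepW D (real j) x with x ≟ j
... | yes _ = inj₂ 𝒇
... | no  _ = inj₁ (nxt D x)
stepW D _ x = inj₁ (nxt D x)

stepOld : (D : BCS) → Pt (m D) → Pt (m D) → Fin (m D) → E⁺ (m D)
stepOld D (real i) w x with x ≟ i
... | yes _ = inj₂ 𝒇′
... | no  _ = stepW D w x
stepOld D _ w x = stepW D w x

stepF : (D : BCS) → Pt (m D) → Pt (m D) → E⁺ (m D)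
stepF D (real i) (real j) with i ≟ j
... | yes _ = inj₂ 𝒇
... | no  _ = inj₁ (nxt D i)
stepF D (real i) _  = inj₁ (nxt D i)
stepF D vγ vγ = inj₂ 𝒇
stepF D wγ wγ = inj₂ 𝒇
stepF D _ _   = inj₂ 𝒇′

stepF′ : (D : BCS) → Pt (m D) → Pt (m D) → E⁺ (m D)
stepF′ D _ (real j) = inj₁ (nxt D j)
stepF′ D vγ vγ = inj₂ 𝒇′
stepF′ D wγ wγ = inj₂ 𝒇′
stepF′ D _ _   = inj₂ 𝒇

-- successor permutation of the digraph D ∪ {split at v, w} ∪ {f, f'}
τ : (D : BCS) → Pt (m D) → Pt (m D) → E⁺ (m D) → E⁺ (m D)
τ D v w (inj₁ x)  = stepOld D v w x
τ D v w (inj₂ 𝒇)  = stepF D v w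
τ D v w (inj₂ 𝒇′) = stepF′ D v w

-- labels: old labels kept, f and f' get one common new label (nothing)
χ⁺ : (D : BCS) → E⁺ (m D) → Maybe ℕ
χ⁺ D (inj₁ x) = just (χ D x)
χ⁺ D (inj₂ _) = nothing

-- D' is (up to equivalence) the sub-digraph of the τ-digraph on the edge
-- set K (a union of τ-cycles), with the new labelling.
Realizes : (D : BCS) → Pt (m D) → Pt (m D) → (E⁺ (m D) → Set) → BCS → Set
Realizes D v w K D' =
  Σ (Fin (m D') → E⁺ (m D)) λ h →
    (∀ x y → h x ≡ h y → x ≡ y) ×
    (∀ x → K (h x)) ×
    (∀ e → K e → ∃[ x ] h x ≡ e) ×
    (∀ x → h (nxt D' x) ≡ τ D v w (h x)) ×
    (∀ x y → (χ D' x ≡ χ D' y) ⇔ (χ⁺ D (h x) ≡ χ⁺ D (h y)))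

Everything : {A : Set} → A → Set
Everything _ = ⊤

-- Moves of restricted Cutter (D̄ = D_k ∖ C, ḡ = g_k in (a),(b),(c)).
-- Ĉ₁ is the τ-cycle through f, Ĉ₂ the τ-cycle through f'.
data Move (γ : GameState) (v w : Pt (m (D γ))) (γ' : GameState) : Set where
  moveA : SameComp (D γ) v w → 1 ≤ g γ →
          Realizes (D γ) v w Everything (D γ') → g γ' ≡ g γ ∸ 1 → Move γ v w γ'
  moveB : SameComp (D γ) v w →
          Realizes (D γ) v w (λ e → ¬ OnCycle (τ (D γ) v w) (inj₂ 𝒇′) e) (D γ') →
          g γ' ≡ g γ → Move γ v w γ'
  moveC : SameComp (D γ) v w →
          Realizes (D γ) v w (λ e → ¬ OnCycle (τ (D γ) v w) (inj₂ 𝒇) e) (D γ') →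
          g γ' ≡ g γ → Move γ v w γ'
  moveD : ¬ SameComp (D γ) v w →
          Realizes (D γ) v w Everything (D γ') → g γ' ≡ g γ → Move γ v w γ'

-- Restricted Cutter, from the current state γ with list of earlier states
-- hist, has a strategy ensuring that the game reaches a state γ* with
-- target ≤ 3 · value γ*.  (Inductive attractor: either the goal holds now,
-- or for every choice of Marker there is a legal restricted move after
-- which Cutter again can force the goal.)
data CutterForces (target : ℕ) : List GameState → GameState → Set where
  reached : ∀ {hist γ} → target ≤ 3 * value γ → CutterForces target hist γ
  step    : ∀ {hist γ} →
            (∀ (v w : Pt (m (D γ))) →
               ∃[ γ' ] Move γ v w γ' × ¬ Forbidden (γ ∷ hist) γ' ×
                       CutterForces target (γ ∷ hist) γ') →
            CutterForces target hist γ

emptyBCS : BCS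
emptyBCS = record { m = 0 ; σ = Perm.id ; χ = λ () ; proper = λ () }

initial : ℕ → GameState
initial g₀ = record { D = emptyBCS ; g = g₀ }

{-# OPTIONS --safe #-}
module Submission where

open import Defs
open import Data.Nat using (ℕ; zero; suc; _≤_; _<_; _*_; _+_; _∸_; z≤n; s≤s)
import Data.Nat as ℕ
open import Data.Nat.Properties hiding (_≟_)
open import Data.Nat.ListAction using (sum)
open import Data.Nat.ListAction.Properties using (sum-++; sum-↭)
open import Data.Nat.Solver using (module +-*-Solver)
open import Data.Fin using (Fin; _≟_)
import Data.Fin.Properties as Fin
open import Data.Fin.Permutation using (permutation; _⟨$⟩ʳ_)
open import Data.List using (List; []; _∷_; _++_; length; map; concat; deduplicate; allFin; tabulate; lookup)
open import Data.List.Properties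
  using (length-tabulate; length-map; length-++; map-++; map-∘; map-tabulate; tabulate-lookup;
         concat-map; concat-++; ++-assoc; ++-identityʳ; ∷-injectiveˡ; ∷-injectiveʳ)
open import Data.List.Membership.Propositional using (_∈_; _∉_; find)
import Data.List.Membership.DecPropositional as DecMembership
open import Data.List.Membership.Propositional.Properties
  using (∈-map⁺; ∈-map⁻; ∈-++⁺ˡ; ∈-++⁺ʳ; ∈-++⁻; ∈-lookup; ∈-length; ∈-allFin; ∈-tabulate⁻;
         ∈-deduplicate⁺; ∈-deduplicate⁻; ∈-concat⁺′; ∈-concat⁻′)
open import Data.List.Relation.Unary.Any as Any using (Any; here; there; index; any?)
open import Data.List.Relation.Unary.Any.Properties using (lookup-index)
open import Data.List.Relation.Unary.All as All using (All; []; _∷_; all?)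
import Data.List.Relation.Unary.All.Properties as All
open import Data.List.Relation.Unary.AllPairs using ([]; _∷_)
open import Data.List.Relation.Unary.Unique.Propositional using (Unique)
import Data.List.Relation.Unary.Unique.Propositional.Properties as Unique
open import Data.List.Relation.Unary.Unique.DecPropositional.Properties ℕ._≟_ using (deduplicate-!)
open import Data.List.Relation.Binary.Permutation.Propositional
  using (_↭_; ↭-refl; ↭-sym; ↭-trans; ↭-reflexive; ↭⇒↭ₛ)
import Data.List.Relation.Binary.Permutation.Propositional.Properties as ↭
import Data.List.Relation.Binary.Permutation.Setoid.Properties as ↭ₛ
open import Data.Maybe using (just)
open import Data.Maybe.Properties using (just-injective)
open import Data.Product using (∃-syntax; ∃₂; _×_; _,_; proj₁; proj₂)
open import Data.Sum using (_⊎_; inj₁; inj₂)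
open import Data.Sum.Properties using (inj₁-injective; inj₂-injective)
open import Data.Unit using (⊤; tt)
open import Data.Empty using (⊥)
open import Function using (_⇔_; _∘_; mk⇔; Equivalence)
open import Relation.Nullary using (¬_; Dec; yes; no; contradiction)
open import Relation.Nullary.Decidable using (_×-dec_)
open import Relation.Binary.PropositionalEquality
open import Relation.Binary.Construct.Closure.ReflexiveTransitive using (Star; ε; _◅_)

-- The number of labels cannot grow under contractions, so every move that increases it is allowed.
-- Give an edge the weight 1, plus 2 if its label occurs only once, plus 1 if the next edge on its
-- cycle has the same label (a fold); let Ω be the total weight, v the value, c the number of cycles
-- and g the counter.  Two properties persist, the second one from the second move on:
--   every cycle has weight at least 4, and Ω + 10 + 8 g₀ ≤ 6 v + 4 c + 8 g.
-- Suppose Marker picks v ≠ w on one cycle, splitting it into arcs a and b.  An arc with at most two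
-- edges, all of whose labels also occur elsewhere, is dropped: this loses no label and raises Ω by
-- at most 5.  If neither arc is of this kind, each of them has weight at least 3, so paying for move
-- (a) leaves two cycles of weight at least 4.  When g = 0 prevents this payment, Ω ≥ 4 c + 2, and
-- the inequality reads 3 v ≥ 4 g₀ + 6.  For all other choices of Marker no label need be lost and
-- nothing is paid.

private variable A B : Set

-- Duplicate-free lists and the pigeonhole principle

lookup-injective : {xs : List A} → Unique xs → ∀ i j → lookup xs i ≡ lookup xs j → i ≡ j
lookup-injective (_  ∷ _)  Fin.zero    Fin.zero    _  = refl
lookup-injective (x∉ ∷ _)  Fin.zero    (Fin.suc j) eq = contradiction eq (All.lookup x∉ (∈-lookup j))
lookup-injective (x∉ ∷ _)  (Fin.suc i) Fin.zero    eq = contradiction (sym eq) (All.lookup x∉ (∈-lookup i))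
lookup-injective (_  ∷ u)  (Fin.suc i) (Fin.suc j) eq = cong Fin.suc (lookup-injective u i j eq)

unique-⊆-length : {xs ys : List A} → Unique xs → (∀ {x} → x ∈ xs → x ∈ ys) → length xs ≤ length ys
unique-⊆-length {xs = xs} {ys} u sub = Fin.injective⇒≤ {f = λ i → index (sub (∈-lookup {xs = xs} i))} λ {i} {j} eq →
  lookup-injective u i j (trans (lookup-index (sub (∈-lookup i)))
    (trans (cong (lookup ys) eq) (sym (lookup-index (sub (∈-lookup j))))))

-- A missed value `y` put in front of the values of `f` would give `suc n` distinct elements of
-- `Fin n`.
Fin-injective⇒surjective : ∀ {n} (f : Fin n → Fin n) → (∀ {x y} → f x ≡ f y → x ≡ y) → ∀ y → ∃[ x ] f x ≡ y
Fin-injective⇒surjective {n} f inj y with Fin.any? (λ x → f x ≟ y)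
... | yes hit = hit
... | no miss = contradiction (unique-⊆-length uniq (λ _ → ∈-allFin _)) (subst (λ k → ¬ (suc k ≤ _)) (sym (length-tabulate f))
                  (subst (λ k → ¬ (suc n ≤ k)) (sym (length-tabulate (λ x → x))) 1+n≰n))
  where
  uniq : Unique (y ∷ tabulate f)
  uniq = All.tabulate⁺ (λ x y≡fx → miss (x , sym y≡fx)) ∷ Unique.tabulate⁺ inj

-- The number of labels in use

labels : BCS → List ℕ
labels D = map (χ D) (allFin (m D))

valueD : BCS → ℕ
valueD D = length (deduplicate ℕ._≟_ (labels D))

∈-labels : ∀ D x → χ D x ∈ labels D
∈-labels D x = ∈-map⁺ (χ D) (∈-allFin x)

-- For every distinct label of `D` an edge carrying it is chosen; since `f` reflects equality of
-- labels, the images of these edges have distinct labels. Contractions and equivalences both supply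
-- such an `f`.
valueD-mono : ∀ D D′ (f : Fin (m D) → Fin (m D′)) →
              (∀ x y → χ D′ (f x) ≡ χ D′ (f y) → χ D x ≡ χ D y) → valueD D ≤ valueD D′
valueD-mono D D′ f reflects = subst (_≤ valueD D′) (length-tabulate image)
  (unique-⊆-length (Unique.tabulate⁺ image-injective)
    (λ k∈ → let i , eq = ∈-tabulate⁻ k∈ in
            ∈-deduplicate⁺ ℕ._≟_ (subst (_∈ labels D′) (sym eq) (∈-labels D′ _))))
  where
  us = deduplicate ℕ._≟_ (labels D)
  edge : ∀ i → ∃[ x ] x ∈ allFin (m D) × lookup us i ≡ χ D x
  edge i = ∈-map⁻ (χ D) (∈-deduplicate⁻ ℕ._≟_ (labels D) (∈-lookup i))
  image : Fin (length us) → ℕ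
  image i = χ D′ (f (proj₁ (edge i)))
  image-injective : ∀ {i j} → image i ≡ image j → i ≡ j
  image-injective {i} {j} eq = lookup-injective (deduplicate-! (labels D)) i j
    (trans (proj₂ (proj₂ (edge i))) (trans (reflects _ _ eq) (sym (proj₂ (proj₂ (edge j))))))

valueD-gain : ∀ D D′ k → k ∉ labels D → k ∈ labels D′ → (∀ x → χ D x ∈ labels D′) → valueD D < valueD D′
valueD-gain D D′ k k∉ k∈ kept = unique-⊆-length
  (All.tabulate (λ l∈ k≡l → k∉ (subst (_∈ labels D) (sym k≡l) (∈-deduplicate⁻ ℕ._≟_ (labels D) l∈))) ∷ deduplicate-! (labels D))
  λ { (here refl) → ∈-deduplicate⁺ ℕ._≟_ k∈
    ; (there l∈) → let x , _ , eq = ∈-map⁻ (χ D) (∈-deduplicate⁻ ℕ._≟_ (labels D) l∈) in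
                   ∈-deduplicate⁺ ℕ._≟_ (subst (_∈ labels D′) (sym eq) (kept x)) }

contraction-value : ∀ {D D′} → Contraction D D′ → valueD D′ ≤ valueD D
contraction-value {D} {D′} (h , _ , _ , _ , _ , _ , _ , χ-h) =
  valueD-mono D′ D h (λ x y eq → trans (χ-h x) (trans eq (sym (χ-h y))))

reduction-value : ∀ {D D′} → Star Contraction D D′ → valueD D′ ≤ valueD D
reduction-value ε        = ≤-refl
reduction-value {D} (_◅_ {j = D₁} c cs) = ≤-trans (reduction-value cs) (contraction-value {D} {D₁} c)

equiv-value : ∀ {γ δ} → Equiv γ δ → value γ ≤ value δ
equiv-value {γ} {δ} (_ , h , _ , lab) = valueD-mono (D γ) (D δ) (h ⟨$⟩ʳ_) (λ x y → Equivalence.from (lab x y))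

increasing⇒allowed : ∀ {hist γ′} → (∀ {γ} → γ ∈ hist → value γ < value γ′) → ¬ Forbidden hist γ′
increasing⇒allowed {γ′ = γ′} smaller (γ , γ∈ , r , (red , _) , eqv) =
  <⇒≱ (smaller γ∈) (≤-trans (equiv-value {γ′} {r} eqv) (reduction-value red))

-- Walks and cycles of a map

-- Walk f x l y: the list l = f x, f (f x), …, y of the points visited after x.
data Walk (f : A → A) : A → List A → A → Set where
  []  : ∀ {x} → Walk f x [] x
  _∷_ : ∀ {x y z l} → f x ≡ y → Walk f y l z → Walk f x (y ∷ l) z

module _ {f : A → A} where

  _++ʷ_ : ∀ {x y z k l} → Walk f x k y → Walk f y l z → Walk f x (k ++ l) z
  []       ++ʷ w = w
  (eq ∷ v) ++ʷ w = eq ∷ (v ++ʷ w)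

  walk-end : ∀ {x y z l} → Walk f x (y ∷ l) z → z ∈ y ∷ l
  walk-end (refl ∷ [])        = here refl
  walk-end (refl ∷ w@(_ ∷ _)) = there (walk-end w)

  walk-split : ∀ {x y z l} → Walk f x l z → y ∈ l →
               ∃₂ λ a b → l ≡ a ++ b × y ∈ a × Walk f x a y × Walk f y b z
  walk-split (eq ∷ w) (here refl) = _ , _ , refl , here refl , eq ∷ [] , w
  walk-split (eq ∷ w) (there y∈)  with walk-split w y∈
  ... | a , b , refl , y∈a , v , v′ = _ , b , refl , there y∈a , eq ∷ v , v′

  iter-shift : ∀ k x → iter f k (f x) ≡ f (iter f k x)
  iter-shift zero    x = refl
  iter-shift (suc k) x = cong f (iter-shift k x)

  walk⇒onCycle : ∀ {x y z l} → Walk f x l z → y ∈ l → OnCycle f x y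
  walk⇒onCycle {x} (refl ∷ w) (here refl) = 1 , refl
  walk⇒onCycle {x} (refl ∷ w) (there y∈)  with walk⇒onCycle w y∈
  ... | k , eq = suc k , trans (sym (iter-shift k x)) eq

-- `base∈` rules out the empty walk. Several rounds are not excluded by the record; in a collection
-- of cycles they are excluded by the requirement that the lists together are a permutation of the
-- edges.
record Cyclic (f : A → A) (l : List A) : Set where
  constructor cyclic
  field
    {base} : A
    base∈  : base ∈ l
    walk   : Walk f base l base

open Cyclic

module _ {f : A → A} where

  cyclic-closed : ∀ {l x} → Cyclic f l → x ∈ l → f x ∈ l
  cyclic-closed c x∈ with walk-split (walk c) x∈
  ... | a , b@(_ ∷ _) , refl , _ , _ , refl ∷ _ = ∈-++⁺ʳ a (here refl)
  -- Here the given point ends the walk, so it is the base, and its successor is the first entry.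
  cyclic-closed (cyclic _ (refl ∷ _)) _ | _ , [] , _ , _ , _ , [] = here refl

  onCycle⇒∈ : ∀ {l x y} → Cyclic f l → x ∈ l → OnCycle f x y → y ∈ l
  onCycle⇒∈ c x∈ (zero  , refl) = x∈
  onCycle⇒∈ c x∈ (suc k , refl) = cyclic-closed c (onCycle⇒∈ c x∈ (k , refl))

  walk-pred : ∀ {x y z l} → Walk f x l z → y ∈ l → ∃[ u ] (u ≡ x ⊎ u ∈ l) × f u ≡ y
  walk-pred (eq ∷ _) (here refl) = _ , inj₁ refl , eq
  walk-pred (_ ∷ w)  (there y∈)  with walk-pred w y∈
  ... | u , inj₁ refl , eq = u , inj₂ (here refl) , eq
  ... | u , inj₂ u∈   , eq = u , inj₂ (there u∈) , eq

  cyclic-pred : ∀ {l y} → Cyclic f l → y ∈ l → ∃[ u ] u ∈ l × f u ≡ y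
  cyclic-pred c y∈ with walk-pred (walk c) y∈
  ... | u , inj₁ refl , eq = u , base∈ c , eq
  ... | u , inj₂ u∈   , eq = u , u∈ , eq

  -- Carries an arc of the old successor map over to the new one, which may differ at both ends: the
  -- arc is entered from `x′`, and nothing is asked at its last point `z`, where it is cut. As `l`
  -- has no repetitions, `z` is not met earlier.
  walk-map : ∀ {g : B → B} (h : A → B) {x z l x′} → Walk f x l z → l ≢ [] → Unique l →
             (∀ {y} → y ∈ l → y ≢ z → g (h y) ≡ h (f y)) → g x′ ≡ h (f x) → Walk g x′ (map h l) (h z)
  walk-map h [] l≢[] _ _ _ = contradiction refl l≢[]
  walk-map h (refl ∷ []) _ _ _ eq = eq ∷ []
  walk-map h (refl ∷ w@(_ ∷ _)) _ (x∉ ∷ u) comm eq =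
    eq ∷ walk-map h w (λ ()) u (comm ∘ there) (comm (here refl) (All.lookup x∉ (walk-end w)))

  walk-map⁻ : ∀ {g : B → B} (h : B → A) → (∀ {x y} → h x ≡ h y → x ≡ y) → (∀ x → h (g x) ≡ f (h x)) →
              ∀ {x y l u v} → u ≡ h x → v ≡ h y → Walk f u (map h l) v → Walk g x l y
  walk-map⁻ h inj comm {l = []}    eq eq′ [] with refl ← inj (trans (sym eq) eq′) = []
  walk-map⁻ h inj comm {l = _ ∷ _} eq eq′ (eq″ ∷ w) =
    inj (trans (comm _) (trans (cong f (sym eq)) eq″)) ∷ walk-map⁻ h inj comm refl eq′ w

  cyclic-map⁻ : ∀ {g : B → B} (h : B → A) → (∀ {x y} → h x ≡ h y → x ≡ y) → (∀ x → h (g x) ≡ f (h x)) →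
                ∀ {l} → Cyclic f (map h l) → Cyclic g l
  cyclic-map⁻ h inj comm c with ∈-map⁻ h (base∈ c)
  ... | x , x∈ , refl = cyclic x∈ (walk-map⁻ h inj comm refl refl (walk c))

-- Disjointness and sums over lists

Unique-resp-↭ : {xs ys : List A} → xs ↭ ys → Unique xs → Unique ys
Unique-resp-↭ p = ↭ₛ.Unique-resp-↭ (setoid _) (↭⇒↭ₛ p)

Unique-++ˡ : ∀ (xs : List A) {ys} → Unique (xs ++ ys) → Unique xs
Unique-++ˡ []       _        = []
Unique-++ˡ (x ∷ xs) (x∉ ∷ u) = All.++⁻ˡ xs x∉ ∷ Unique-++ˡ xs u

Unique-++ʳ : ∀ (xs : List A) {ys} → Unique (xs ++ ys) → Unique ys
Unique-++ʳ []       u       = u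
Unique-++ʳ (x ∷ xs) (_ ∷ u) = Unique-++ʳ xs u

Unique-++-disjoint : ∀ (xs : List A) {ys x} → Unique (xs ++ ys) → x ∈ xs → x ∉ ys
Unique-++-disjoint (x ∷ xs) (x∉ ∷ _) (here refl) x∈ys = All.lookup x∉ (∈-++⁺ʳ xs x∈ys) refl
Unique-++-disjoint (_ ∷ xs) (_ ∷ u)  (there x∈)  x∈ys = Unique-++-disjoint xs u x∈ x∈ys

Σ[_] : (A → ℕ) → List A → ℕ
Σ[ f ] xs = sum (map f xs)

module _ {f g : A → ℕ} where

  Σ-cong : ∀ xs → (∀ {x} → x ∈ xs → f x ≡ g x) → Σ[ f ] xs ≡ Σ[ g ] xs
  Σ-cong []       _  = refl
  Σ-cong (x ∷ xs) eq = cong₂ _+_ (eq (here refl)) (Σ-cong xs (eq ∘ there))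

  Σ-mono : ∀ xs → (∀ {x} → x ∈ xs → f x ≤ g x) → Σ[ f ] xs ≤ Σ[ g ] xs
  Σ-mono []       _  = z≤n
  Σ-mono (x ∷ xs) le = +-mono-≤ (le (here refl)) (Σ-mono xs (le ∘ there))

  Σ-mono-at : ∀ {k c} xs → (∀ x → f x ≤ g x) → k ∈ xs → f k + c ≤ g k → Σ[ f ] xs + c ≤ Σ[ g ] xs
  Σ-mono-at {c = c} (x ∷ xs) le (here refl) lek = ≤-trans
    (≤-reflexive (solve 3 (λ a b c → (a :+ b) :+ c := (a :+ c) :+ b) refl (f x) (Σ[ f ] xs) c))
    (+-mono-≤ lek (Σ-mono xs (λ {x} _ → le x)))
    where open +-*-Solver
  Σ-mono-at {c = c} (x ∷ xs) le (there k∈) lek = ≤-trans (≤-reflexive (+-assoc (f x) _ c))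
    (+-mono-≤ (le x) (Σ-mono-at xs le k∈ lek))

  Σ-+ : ∀ xs → Σ[ (λ x → f x + g x) ] xs ≡ Σ[ f ] xs + Σ[ g ] xs
  Σ-+ []       = refl
  Σ-+ (x ∷ xs) rewrite Σ-+ xs =
    solve 4 (λ a b c d → (a :+ b) :+ (c :+ d) := (a :+ c) :+ (b :+ d)) refl (f x) (g x) (Σ[ f ] xs) (Σ[ g ] xs)
    where open +-*-Solver

module _ (f : A → ℕ) where

  Σ-++ : ∀ xs ys → Σ[ f ] (xs ++ ys) ≡ Σ[ f ] xs + Σ[ f ] ys
  Σ-++ xs ys = trans (cong sum (map-++ f xs ys)) (sum-++ (map f xs) (map f ys))

  Σ-↭ : ∀ {xs ys} → xs ↭ ys → Σ[ f ] xs ≡ Σ[ f ] ys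
  Σ-↭ = sum-↭ ∘ ↭.map⁺ f

  Σ-map : (h : B → A) → ∀ xs → Σ[ f ] (map h xs) ≡ Σ[ f ∘ h ] xs
  Σ-map h xs = cong sum (sym (map-∘ xs))

  length≤Σ : ∀ xs → (∀ x → 1 ≤ f x) → length xs ≤ Σ[ f ] xs
  length≤Σ []       _  = z≤n
  length≤Σ (x ∷ xs) le = +-mono-≤ (le x) (length≤Σ xs le)

  Σ-∈ : ∀ {x xs} → x ∈ xs → f x ≤ Σ[ f ] xs
  Σ-∈ (here refl) = m≤m+n _ _
  Σ-∈ (there x∈)  = ≤-trans (Σ-∈ x∈) (m≤n+m _ _)

-- Multiplicities of labels and the bonus for rare ones

δ : ℕ → ℕ → ℕ
δ k l with k ℕ.≟ l
... | yes _ = 1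
... | no  _ = 0

δ-≡ : ∀ {k l} → k ≡ l → δ k l ≡ 1
δ-≡ {k} {l} eq with k ℕ.≟ l
... | yes _ = refl
... | no ¬eq = contradiction eq ¬eq

δ-≢ : ∀ {k l} → k ≢ l → δ k l ≡ 0
δ-≢ {k} {l} ¬eq with k ℕ.≟ l
... | yes eq = contradiction eq ¬eq
... | no _ = refl

δ≤1 : ∀ k l → δ k l ≤ 1
δ≤1 k l with k ℕ.≟ l
... | yes _ = ≤-refl
... | no  _ = z≤n

occ : ℕ → List ℕ → ℕ
occ k = Σ[ δ k ]

occ-∉ : ∀ {k} ks → k ∉ ks → occ k ks ≡ 0
occ-∉ []       _  = refl
occ-∉ {k} (l ∷ ks) k∉ = cong₂ _+_ (δ-≢ (k∉ ∘ here)) (occ-∉ ks (k∉ ∘ there))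

-- The extra weight of a label occurring once. The value at 0 keeps the function antitone, so
-- multiplicities can be compared without checking that the label occurs.
bonus : ℕ → ℕ
bonus 0 = 2
bonus 1 = 2
bonus (suc (suc _)) = 0

bonus≤2 : ∀ n → bonus n ≤ 2
bonus≤2 0 = ≤-refl
bonus≤2 1 = ≤-refl
bonus≤2 (suc (suc _)) = z≤n

bonus-antitone : ∀ {k n} → k ≤ n → bonus n ≤ bonus k
bonus-antitone {0}           {n} _ = bonus≤2 n
bonus-antitone {1}           {n} _ = bonus≤2 n
bonus-antitone {suc (suc _)} {suc (suc _)} _ = z≤n
bonus-antitone {suc (suc _)} {suc zero} (s≤s ())

bonus*≤2 : ∀ {k n} → k ≤ n → bonus n * k ≤ 2
bonus*≤2 {n = 0}           z≤n       = z≤n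
bonus*≤2 {n = 1}           z≤n       = z≤n
bonus*≤2 {n = 1}           (s≤s z≤n) = ≤-refl
bonus*≤2 {n = suc (suc _)} _         = z≤n

-- One more occurrence of `b` changes the bonus only at the `occ b ks` entries equal to `b`, each of
-- which loses at most `bonus (c b)`.
bonus-step : (c : ℕ → ℕ) → ∀ b ks →
             Σ[ bonus ∘ c ] ks ≤ Σ[ (λ k → bonus (δ k b + c k)) ] ks + bonus (c b) * occ b ks
bonus-step c b []       = z≤n
bonus-step c b (k ∷ ks) with k ℕ.≟ b | b ℕ.≟ k | bonus-step c b ks
... | yes refl | no b≢b  | _  = contradiction refl b≢b
... | no k≢b   | yes b≡k | _  = contradiction (sym b≡k) k≢b
... | no _     | no _    | ih = ≤-trans (+-monoʳ-≤ (bonus (c k)) ih) (≤-reflexive (sym (+-assoc (bonus (c k)) _ _)))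
... | yes refl | yes _   | ih = ≤-trans (+-monoʳ-≤ (bonus (c k)) ih) (≤-trans
        (≤-reflexive (solve 3 (λ x s o → x :+ (s :+ x :* o) := s :+ x :* (con 1 :+ o)) refl
                              (bonus (c k)) (Σ[ (λ k′ → bonus (δ k′ k + c k′)) ] ks) (occ k ks)))
        (+-monoˡ-≤ _ (m≤n+m _ (bonus (1 + c k)))))
  where open +-*-Solver

-- Taking the labels of `bs` away one at a time raises the total bonus by at most 2 each: either `b`
-- is still counted at least twice and earns no bonus, or at most one entry of `ks` gains it.
bonus-drop : (c : ℕ → ℕ) → ∀ ks bs → (∀ k → occ k ks ≤ c k) →
             Σ[ bonus ∘ c ] ks ≤ Σ[ (λ k → bonus (occ k bs + c k)) ] ks + 2 * length bs
bonus-drop c ks []       le = ≤-reflexive (sym (+-identityʳ _))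
bonus-drop c ks (b ∷ bs) le = begin
  Σ[ bonus ∘ c ] ks
    ≤⟨ bonus-drop c ks bs le ⟩
  Σ[ bonus ∘ c′ ] ks + 2 * length bs
    ≤⟨ +-monoˡ-≤ _ (bonus-step c′ b ks) ⟩
  Σ[ (λ k → bonus (δ k b + c′ k)) ] ks + bonus (c′ b) * occ b ks + 2 * length bs
    ≤⟨ +-monoˡ-≤ (2 * length bs) (+-monoʳ-≤ (Σ[ (λ k → bonus (δ k b + c′ k)) ] ks) (bonus*≤2 (≤-trans (le b) (m≤n+m (c b) (occ b bs))))) ⟩
  Σ[ (λ k → bonus (δ k b + c′ k)) ] ks + 2 + 2 * length bs
    ≡⟨ cong (λ s → s + 2 + 2 * length bs) (Σ-cong ks (λ {k} _ → cong bonus (sym (+-assoc (δ k b) (occ k bs) (c k))))) ⟩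
  Σ[ (λ k → bonus (occ k (b ∷ bs) + c k)) ] ks + 2 + 2 * length bs
    ≡⟨ solve 2 (λ s l → s :+ con 2 :+ con 2 :* l := s :+ con 2 :* (con 1 :+ l)) refl
             (Σ[ (λ k → bonus (occ k (b ∷ bs) + c k)) ] ks) (length bs) ⟩
  Σ[ (λ k → bonus (occ k (b ∷ bs) + c k)) ] ks + 2 * length (b ∷ bs) ∎
  where
  open ≤-Reasoning
  open +-*-Solver using (solve; _:+_; _:*_; _:=_; con)
  c′ : ℕ → ℕ
  c′ k = occ k bs + c k

-- Edge weights and heavy cycles

-- Successor map, labelling and list of labels are parameters, so that the same formula also weighs
-- the edges in `E⁺` before they are numbered. The last summand marks a fold.
weight : (A → A) → (A → ℕ) → List ℕ → A → ℕ
weight f lab ks x = 1 + (bonus (occ (lab x) ks) + δ (lab (f x)) (lab x))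

ω : (D : BCS) → Fin (m D) → ℕ
ω D = weight (nxt D) (χ D) (labels D)

Ω : BCS → ℕ
Ω D = Σ[ ω D ] (allFin (m D))

fold⇒2≤ω : ∀ D {x} → χ D (nxt D x) ≡ χ D x → 2 ≤ ω D x
fold⇒2≤ω D eq = s≤s (≤-trans (≤-reflexive (sym (δ-≡ eq))) (m≤n+m _ _))

record Cell (D : BCS) (l : List (Fin (m D))) : Set where
  constructor cell
  field
    isCycle : Cyclic (nxt D) l
    heavy   : 4 ≤ Σ[ ω D ] l

-- Carrying out a move

map-≡-++ : (h : A → B) → ∀ xs {ys} zs → map h zs ≡ xs ++ ys →
           ∃₂ λ us vs → zs ≡ us ++ vs × map h us ≡ xs × map h vs ≡ ys
map-≡-++ h []       zs       eq = [] , zs , refl , refl , eq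
map-≡-++ h (x ∷ xs) (z ∷ zs) eq with map-≡-++ h xs zs (∷-injectiveʳ eq)
... | us , vs , refl , eq₁ , eq₂ = z ∷ us , vs , refl , cong₂ _∷_ (∷-injectiveˡ eq) eq₁ , eq₂

-- Serves to carry the grouping of edges of `E⁺` into cycles back to their numbers.
unconcat : (h : A → B) → ∀ xss ys → map h ys ≡ concat xss →
           ∃[ yss ] concat yss ≡ ys × map (map h) yss ≡ xss
unconcat h []         []  eq = [] , refl , refl
unconcat h (xs ∷ xss) ys  eq with map-≡-++ h xs ys eq
... | us , vs , refl , refl , eq′ with unconcat h xss vs eq′
... | yss , refl , refl = us ∷ yss , refl , refl

lab : (D : BCS) → E⁺ (m D) → ℕ
lab D (inj₁ x) = χ D x
lab D (inj₂ _) = suc (Σ[ (λ k → k) ] (labels D))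

fresh∉ : ∀ D → suc (Σ[ (λ k → k) ] (labels D)) ∉ labels D
fresh∉ D ∈ = 1+n≰n (Σ-∈ (λ k → k) ∈)

fresh≢ : ∀ {D x n} → lab D (inj₂ n) ≢ χ D x
fresh≢ {D} {x} eq = fresh∉ D (subst (_∈ labels D) (sym eq) (∈-labels D x))

χ⁺⇔lab : ∀ D e e′ → lab D e ≡ lab D e′ ⇔ χ⁺ D e ≡ χ⁺ D e′
χ⁺⇔lab D (inj₁ x) (inj₁ y) = mk⇔ (cong just) just-injective
χ⁺⇔lab D (inj₁ x) (inj₂ n) = mk⇔ (λ eq → contradiction (sym eq) (fresh≢ {D} {x} {n})) λ ()
χ⁺⇔lab D (inj₂ n) (inj₁ x) = mk⇔ (λ eq → contradiction eq (fresh≢ {D} {x} {n})) λ ()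
χ⁺⇔lab D (inj₂ n) (inj₂ _) = mk⇔ (λ _ → refl) (λ _ → refl)

NewEdge-pigeonhole : ∀ (k l n : NewEdge) → k ≡ l ⊎ l ≡ n ⊎ k ≡ n
NewEdge-pigeonhole 𝒇  𝒇  _  = inj₁ refl
NewEdge-pigeonhole 𝒇′ 𝒇′ _  = inj₁ refl
NewEdge-pigeonhole 𝒇  𝒇′ 𝒇′ = inj₂ (inj₁ refl)
NewEdge-pigeonhole 𝒇′ 𝒇  𝒇  = inj₂ (inj₁ refl)
NewEdge-pigeonhole 𝒇  𝒇′ 𝒇  = inj₂ (inj₂ refl)
NewEdge-pigeonhole 𝒇′ 𝒇  𝒇′ = inj₂ (inj₂ refl)

lab-proper : ∀ D e₁ e₂ e₃ → lab D e₁ ≡ lab D e₂ → lab D e₂ ≡ lab D e₃ → e₁ ≡ e₂ ⊎ e₂ ≡ e₃ ⊎ e₁ ≡ e₃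
lab-proper D (inj₁ x) (inj₁ y) (inj₁ z) p q with proper D x y z p q
... | inj₁ eq        = inj₁ (cong inj₁ eq)
... | inj₂ (inj₁ eq) = inj₂ (inj₁ (cong inj₁ eq))
... | inj₂ (inj₂ eq) = inj₂ (inj₂ (cong inj₁ eq))
lab-proper D (inj₂ k) (inj₂ l) (inj₂ n) p q with NewEdge-pigeonhole k l n
... | inj₁ eq        = inj₁ (cong inj₂ eq)
... | inj₂ (inj₁ eq) = inj₂ (inj₁ (cong inj₂ eq))
... | inj₂ (inj₂ eq) = inj₂ (inj₂ (cong inj₂ eq))
lab-proper D (inj₁ x) (inj₂ n) _        p q = contradiction (sym p) (fresh≢ {D} {x} {n})
lab-proper D (inj₂ n) (inj₁ x) _        p q = contradiction p (fresh≢ {D} {x} {n})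
lab-proper D (inj₁ _) (inj₁ x) (inj₂ n) p q = contradiction (sym q) (fresh≢ {D} {x} {n})
lab-proper D (inj₂ _) (inj₂ n) (inj₁ x) p q = contradiction q (fresh≢ {D} {x} {n})

-- The cycles present after a move, as lists in `E⁺` not yet numbered. By `echo` every label of a
-- dropped edge survives on a kept one, so together with `someNew` the value rises.
record Surgery (D : BCS) (v w : Pt (m D)) : Set where
  field
    cells   : List (List (E⁺ (m D)))
    kept    : List (Fin (m D))
    dropped : List (Fin (m D))
    news    : List NewEdge
    cycles  : All (Cyclic (τ D v w)) cells
    old     : kept ++ dropped ↭ allFin (m D)
    content : concat cells ↭ map inj₁ kept ++ map inj₂ news
    news!   : Unique news
    someNew : ∃[ n ] n ∈ news
    echo    : ∀ {x} → x ∈ dropped → ∃[ y ] y ∈ kept × χ D x ≡ χ D y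

  -- The labels are listed in the order of `content`, which separates old from new edges, rather
  -- than that of `edges`; multiplicities do not depend on the order.
  weight⁺ : E⁺ (m D) → ℕ
  weight⁺ = weight (τ D v w) (lab D) (map (lab D) (map inj₁ kept ++ map inj₂ news))

  edges : List (E⁺ (m D))
  edges = concat cells

  old! : Unique (kept ++ dropped)
  old! = Unique-resp-↭ (↭-sym old) (Unique.allFin⁺ _)

  edges! : Unique edges
  edges! = Unique-resp-↭ (↭-sym content) (Unique.++⁺
    (Unique.map⁺ inj₁-injective (Unique-++ˡ kept old!)) (Unique.map⁺ inj₂-injective news!)
    λ (∈₁ , ∈₂) → let x , _ , eq₁ = ∈-map⁻ inj₁ ∈₁ ; n , _ , eq₂ = ∈-map⁻ inj₂ ∈₂ in
                  contradiction (trans (sym eq₁) eq₂) λ ())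

  old∈ : ∀ {x} → x ∈ kept → inj₁ x ∈ edges
  old∈ x∈ = ↭.∈-resp-↭ (↭-sym content) (∈-++⁺ˡ (∈-map⁺ inj₁ x∈))

  new∈ : ∀ {n} → n ∈ news → inj₂ n ∈ edges
  new∈ n∈ = ↭.∈-resp-↭ (↭-sym content) (∈-++⁺ʳ (map inj₁ kept) (∈-map⁺ inj₂ n∈))

  h : Fin (length edges) → E⁺ (m D)
  h = lookup edges

  h-injective : ∀ {i j} → h i ≡ h j → i ≡ j
  h-injective = lookup-injective edges! _ _

  closed : ∀ {e} → e ∈ edges → τ D v w e ∈ edges
  closed e∈ with ∈-concat⁻′ cells e∈
  ... | L , e∈L , L∈ = ∈-concat⁺′ (cyclic-closed (All.lookup cycles L∈) e∈L) L∈

  previous : ∀ {e} → e ∈ edges → ∃[ u ] u ∈ edges × τ D v w u ≡ e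
  previous e∈ with ∈-concat⁻′ cells e∈
  ... | L , e∈L , L∈ with cyclic-pred (All.lookup cycles L∈) e∈L
  ... | u , u∈L , eq = u , ∈-concat⁺′ u∈L L∈ , eq

  next prev : Fin (length edges) → Fin (length edges)
  next i = index (closed (∈-lookup i))
  prev i = index (proj₁ (proj₂ (previous (∈-lookup i))))

  h-next : ∀ i → h (next i) ≡ τ D v w (h i)
  h-next i = sym (lookup-index (closed (∈-lookup i)))

  next-prev : ∀ i → next (prev i) ≡ i
  next-prev i = h-injective (trans (h-next (prev i))
    (trans (cong (τ D v w) (sym (lookup-index (proj₁ (proj₂ before))))) (proj₂ (proj₂ before))))
    where before = previous (∈-lookup {xs = edges} i)

  -- `next-prev` makes `prev` injective, hence surjective on a finite set, so its left inverse
  -- `next` is two-sided.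
  prev-next : ∀ i → prev (next i) ≡ i
  prev-next i = let j , eq = Fin-injective⇒surjective prev prev-injective i in
    trans (cong (λ k → prev (next k)) (sym eq)) (trans (cong prev (next-prev j)) eq)
    where
    prev-injective : ∀ {x y} → prev x ≡ prev y → x ≡ y
    prev-injective {x} {y} eq = trans (sym (next-prev x)) (trans (cong next eq) (next-prev y))

  result : BCS
  result = record
    { m      = length edges
    ; σ      = permutation next prev next-prev prev-next
    ; χ      = lab D ∘ h
    ; proper = λ i j k p q → reflect (lab-proper D (h i) (h j) (h k) p q)
    }
    where
    reflect : ∀ {i j k} → h i ≡ h j ⊎ h j ≡ h k ⊎ h i ≡ h k → i ≡ j ⊎ j ≡ k ⊎ i ≡ k
    reflect (inj₁ eq)        = inj₁ (h-injective eq)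
    reflect (inj₂ (inj₁ eq)) = inj₂ (inj₁ (h-injective eq))
    reflect (inj₂ (inj₂ eq)) = inj₂ (inj₂ (h-injective eq))

  realizes : (K : E⁺ (m D) → Set) → (∀ {e} → e ∈ edges → K e) → (∀ {e} → K e → e ∈ edges) →
             Realizes D v w K result
  realizes K sound complete =
    h , (λ _ _ → h-injective) , (λ _ → sound (∈-lookup _)) ,
    (λ e Ke → index (complete Ke) , sym (lookup-index (complete Ke))) ,
    h-next , (λ x y → χ⁺⇔lab D (h x) (h y))

  h-allFin : map h (allFin _) ≡ edges
  h-allFin = trans (map-tabulate _ h) (tabulate-lookup edges)

  labels-result : labels result ≡ map (lab D) edges
  labels-result = trans (map-∘ (allFin _)) (cong (map (lab D)) h-allFin)

  ω-result : ∀ i → ω result i ≡ weight⁺ (h i)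
  ω-result i = cong₂ (λ o s → 1 + (bonus o + δ (lab D s) (lab D (h i))))
    (trans (cong (occ _) labels-result) (Σ-↭ (δ _) (↭.map⁺ (lab D) content))) (h-next i)

  Σω-result : ∀ l → Σ[ ω result ] l ≡ Σ[ weight⁺ ] (map h l)
  Σω-result l = trans (Σ-cong l (λ {i} _ → ω-result i)) (sym (Σ-map weight⁺ h l))

  value-result : valueD D < valueD result
  value-result = valueD-gain D result _ (fresh∉ D) (edge⇒label (new∈ (proj₂ someNew))) kept⇒label
    where
    edge⇒label : ∀ {e} → e ∈ edges → lab D e ∈ labels result
    edge⇒label e∈ = subst (_ ∈_) (sym labels-result) (∈-map⁺ (lab D) e∈)
    kept⇒label : ∀ x → χ D x ∈ labels result
    kept⇒label x with ∈-++⁻ kept (↭.∈-resp-↭ (↭-sym old) (∈-allFin x))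
    ... | inj₁ x∈ = edge⇒label (old∈ x∈)
    ... | inj₂ x∈ with echo x∈
    ... | y , y∈ , eq = subst (_∈ labels result) (sym eq) (edge⇒label (old∈ y∈))

  partition-result : All (λ L → 4 ≤ Σ[ weight⁺ ] L) cells →
                     ∃[ ls ] All (Cell result) ls × concat ls ↭ allFin (m result) × length ls ≡ length cells
  partition-result heavy with unconcat h cells (allFin _) h-allFin
  ... | ls , ls≡ , map≡ = ls , All.tabulate good , ↭-reflexive ls≡ ,
                          trans (sym (length-map (map h) ls)) (cong length map≡)
    where
    good : ∀ {l} → l ∈ ls → Cell result l
    good {l} l∈ = cell (cyclic-map⁻ h h-injective h-next (All.lookup cycles L∈))
                       (subst (4 ≤_) (sym (Σω-result l)) (All.lookup heavy L∈))
      where L∈ = subst (map h l ∈_) map≡ (∈-map⁺ (map h) l∈)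

  occ-old : ∀ x → occ (χ D x) (map (lab D) (map inj₁ kept ++ map inj₂ news)) ≡ occ (χ D x) (map (χ D) kept)
  occ-old x = trans (Σ-map (δ _) (lab D) (map inj₁ kept ++ map inj₂ news))
    (trans (Σ-++ (δ (χ D x) ∘ lab D) (map inj₁ kept) (map inj₂ news))
    (trans (cong₂ _+_ (trans (Σ-map _ inj₁ kept) (sym (Σ-map _ (χ D) kept)))
                      (trans (Σ-map _ inj₂ news) (zeros news)))
           (+-identityʳ _)))
    where
    zeros : ∀ ns → Σ[ (λ n → δ (χ D x) (lab D (inj₂ n))) ] ns ≡ 0
    zeros []       = refl
    zeros (n ∷ ns) = cong₂ _+_ (δ-≢ (fresh≢ {D} {x} {n} ∘ sym)) (zeros ns)

  occ-labels : ∀ k → occ k (labels D) ≡ occ k (map (χ D) dropped) + occ k (map (χ D) kept)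
  occ-labels k = trans (sym (Σ-↭ (δ k) (↭.map⁺ (χ D) old)))
    (trans (cong (occ k) (map-++ (χ D) kept dropped))
    (trans (Σ-++ (δ k) (map (χ D) kept) _) (+-comm (occ k (map (χ D) kept)) _)))

  private
    bonus⁺ fold⁺ fold : Fin (m D) → ℕ
    bonus⁺ x = bonus (occ (χ D x) (map (χ D) kept))
    fold⁺ x  = δ (lab D (τ D v w (inj₁ x))) (χ D x)
    fold x   = δ (χ D (nxt D x)) (χ D x)

  weight⁺-old : ∀ x → weight⁺ (inj₁ x) ≡ 1 + (bonus⁺ x + fold⁺ x)
  weight⁺-old x = cong (λ o → 1 + (bonus o + fold⁺ x)) (occ-old x)

  occ-kept : ∀ x → occ (χ D x) (map (χ D) kept) ≤ occ (χ D x) (labels D)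
  occ-kept x = ≤-trans (m≤n+m _ _) (≤-reflexive (sym (occ-labels (χ D x))))

  bonus≤weight⁺ : ∀ x → 1 + bonus (occ (χ D x) (labels D)) ≤ weight⁺ (inj₁ x)
  bonus≤weight⁺ x = ≤-trans
    (s≤s (≤-trans (bonus-antitone (occ-kept x)) (m≤m+n (bonus⁺ x) (fold⁺ x))))
    (≤-reflexive (sym (weight⁺-old x)))

  -- The fold is the same because the successor is, and the bonus cannot shrink because the label is
  -- used no more often than before.
  weight-untouched : ∀ {x} → τ D v w (inj₁ x) ≡ inj₁ (nxt D x) → ω D x ≤ weight⁺ (inj₁ x)
  weight-untouched {x} eq = ≤-trans
    (s≤s (+-mono-≤ (bonus-antitone (occ-kept x))
                   (≤-reflexive (cong (λ e → δ (lab D e) (χ D x)) (sym eq)))))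
    (≤-reflexive (sym (weight⁺-old x)))

  -- Summand by summand: the units agree, each dropped edge raises the total bonus of the kept edges
  -- by at most 2, and `c` is weight saved on folds.
  ΣΩ-result : ∀ c → Σ[ fold⁺ ] kept + c ≤ Σ[ fold ] kept →
              Ω result + c ≤ Σ[ ω D ] kept + 2 * length dropped + Σ[ weight⁺ ∘ inj₂ ] news
  ΣΩ-result c fold≤ = begin
    Ω result + c
      ≡⟨ cong (_+ c) (trans (Σω-result (allFin _)) (trans (cong Σ[ weight⁺ ] h-allFin) (trans (Σ-↭ weight⁺ content)
           (trans (Σ-++ weight⁺ (map inj₁ kept) _)
                  (cong₂ _+_ (trans (Σ-map weight⁺ inj₁ kept) (Σ-cong kept (λ {x} _ → weight⁺-old x))) (Σ-map weight⁺ inj₂ news)))))) ⟩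
    Σ[ (λ x → 1 + (bonus⁺ x + fold⁺ x)) ] kept + N + c
      ≡⟨ cong (λ s → s + N + c) (trans (Σ-+ kept) (cong (Σ[ (λ _ → 1) ] kept +_) (Σ-+ {f = bonus⁺} kept))) ⟩
    Σ[ (λ _ → 1) ] kept + (Σ[ bonus⁺ ] kept + Σ[ fold⁺ ] kept) + N + c
      ≡⟨ solve 5 (λ o b f n c → (o :+ (b :+ f)) :+ n :+ c := (o :+ (b :+ (f :+ c))) :+ n) refl
           (Σ[ (λ _ → 1) ] kept) (Σ[ bonus⁺ ] kept) (Σ[ fold⁺ ] kept) N c ⟩
    Σ[ (λ _ → 1) ] kept + (Σ[ bonus⁺ ] kept + (Σ[ fold⁺ ] kept + c)) + N
      ≤⟨ +-monoˡ-≤ N (+-monoʳ-≤ (Σ[ (λ _ → 1) ] kept) (+-mono-≤ bonus≤ fold≤)) ⟩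
    Σ[ (λ _ → 1) ] kept + (Σ[ bonus° ] kept + 2 * length dropped + Σ[ fold ] kept) + N
      ≡⟨ solve 5 (λ o b d f n → (o :+ (b :+ d :+ f)) :+ n := (o :+ (b :+ f)) :+ d :+ n) refl
           (Σ[ (λ _ → 1) ] kept) (Σ[ bonus° ] kept) (2 * length dropped) (Σ[ fold ] kept) N ⟩
    Σ[ (λ _ → 1) ] kept + (Σ[ bonus° ] kept + Σ[ fold ] kept) + 2 * length dropped + N
      ≡⟨ cong (λ s → s + 2 * length dropped + N)
           (sym (trans (Σ-+ kept) (cong (Σ[ (λ _ → 1) ] kept +_) (Σ-+ {f = bonus°} kept)))) ⟩
    Σ[ ω D ] kept + 2 * length dropped + N ∎
    where
    open ≤-Reasoning
    open +-*-Solver using (solve; _:+_; _:=_)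
    N = Σ[ weight⁺ ∘ inj₂ ] news
    bonus° : Fin (m D) → ℕ
    bonus° x = bonus (occ (χ D x) (labels D))
    bonus≤ : Σ[ bonus⁺ ] kept ≤ Σ[ bonus° ] kept + 2 * length dropped
    bonus≤ = begin
      Σ[ bonus⁺ ] kept
        ≡⟨ sym (Σ-map (λ k → bonus (occ k (map (χ D) kept))) (χ D) kept) ⟩
      Σ[ (λ k → bonus (occ k (map (χ D) kept))) ] (map (χ D) kept)
        ≤⟨ bonus-drop (λ k → occ k (map (χ D) kept)) (map (χ D) kept) (map (χ D) dropped) (λ _ → ≤-refl) ⟩
      Σ[ (λ k → bonus (occ k (map (χ D) dropped) + occ k (map (χ D) kept))) ] (map (χ D) kept) + 2 * length (map (χ D) dropped)
        ≡⟨ cong₂ (λ s l → s + 2 * l)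
             (trans (Σ-map _ (χ D) kept) (Σ-cong kept (λ {x} _ → cong bonus (sym (occ-labels (χ D x))))))
             (length-map (χ D) dropped) ⟩
      Σ[ bonus° ] kept + 2 * length dropped ∎

-- Cells and expensive arcs

Σ-concat : ∀ {A : Set} (f : A → ℕ) k xss → All (λ xs → k ≤ Σ[ f ] xs) xss → length xss * k ≤ Σ[ f ] (concat xss)
Σ-concat f k []         []       = z≤n
Σ-concat f k (xs ∷ xss) (p ∷ ps) = ≤-trans (+-mono-≤ p (Σ-concat f k xss ps)) (≤-reflexive (sym (Σ-++ f xs (concat xss))))

module _ {D : BCS} where

  -- The cycle through `i` is taken out and rotated so that its list ends at `i`, where it can be
  -- cut.
  focus : ∀ {i} ls → All (Cell D) ls → i ∈ concat ls →
          ∃₂ λ l ρ → Walk (nxt D) i l i × i ∈ l × All (Cell D) ρ ×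
                     concat ls ↭ l ++ concat ρ × length ls ≡ suc (length ρ)
  focus (l ∷ ls) (c ∷ cs) i∈ with ∈-++⁻ l i∈
  ... | inj₂ i∈ls with focus ls cs i∈ls
  ...   | l′ , ρ , w , i∈l′ , cs′ , p , len =
    l′ , l ∷ ρ , w , i∈l′ , c ∷ cs′ , ↭-trans (↭.++⁺ˡ l p) (↭.shifts l l′) , cong suc len
  focus (l ∷ ls) (c ∷ cs) i∈ | inj₁ i∈l with walk-split (Cyclic.walk (Cell.isCycle c)) i∈l
  ... | a , b , refl , i∈a , wa , wb =
    b ++ a , ls , wb ++ʷ wa , ∈-++⁺ʳ b i∈a , cs , ↭.++⁺ʳ (concat ls) (↭.++-comm a b) , refl

  1≤ω : ∀ x → 1 ≤ ω D x
  1≤ω x = s≤s z≤n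

  -- `out` stands for the edges outside the arc: an equal label within the arc does not count, since
  -- it would be lost together with the arc.
  Cheap : List (Fin (m D)) → List (Fin (m D)) → Set
  Cheap a out = length a ≤ 2 × All (λ x → Any (λ y → χ D x ≡ χ D y) out) a

  cheap? : ∀ a out → Dec (Cheap a out)
  cheap? a out = (length a ℕ.≤? 2) ×-dec all? (λ x → any? (λ y → χ D x ℕ.≟ χ D y) out) a

  module _ {a out : List (Fin (m D))} (cover : a ++ out ↭ allFin (m D)) (expensive : ¬ Cheap a out)
           (u : Fin (m D) → ℕ) (bonus≤u : ∀ x → 1 + bonus (occ (χ D x) (labels D)) ≤ u x) where

    private
      1≤u : ∀ x → 1 ≤ u x
      1≤u x = ≤-trans (s≤s z≤n) (bonus≤u x)

      once : ∀ x → occ (χ D x) (map (χ D) a) ≤ 1 → ¬ Any (λ y → χ D x ≡ χ D y) out → 3 ≤ u x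
      once x occ≤1 none = ≤-trans (s≤s (bonus-antitone (≤-trans (≤-reflexive occ≡) occ≤1))) (bonus≤u x)
        where
        occ≡ : occ (χ D x) (labels D) ≡ occ (χ D x) (map (χ D) a)
        occ≡ = trans (sym (Σ-↭ (δ _) (↭.map⁺ (χ D) cover)))
          (trans (cong (occ _) (map-++ (χ D) a out))
          (trans (Σ-++ (δ (χ D x)) (map (χ D) a) _)
          (trans (cong (occ (χ D x) (map (χ D) a) +_)
                   (occ-∉ (map (χ D) out) (λ k∈ → let y , y∈ , eq = ∈-map⁻ (χ D) k∈ in none (Any.map (λ { refl → eq }) y∈))))
                 (+-identityʳ _))))

    -- Applied with `u` the old weight and with `u` the weight after the move. No fold is claimed at
    -- the last edge `j`, which is followed by a new edge after the cut.
    arc-heavy : ∀ {i j} → Walk (nxt D) i a j → a ≢ [] → Unique a →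
                (∀ {x} → x ∈ a → x ≢ j → χ D (nxt D x) ≡ χ D x → 2 ≤ u x) → 3 ≤ Σ[ u ] a
    arc-heavy [] a≢[] _ _ = contradiction refl a≢[]
    -- A single edge whose label is not found outside carries a label occurring once: 1 + 2.
    arc-heavy {j = x} (_ ∷ []) _ _ _ with any? (λ y → χ D x ℕ.≟ χ D y) out
    ... | yes some = contradiction (s≤s z≤n , some ∷ []) expensive
    ... | no none  = ≤-trans (once x (≤-trans (≤-reflexive (+-identityʳ _)) (δ≤1 (χ D x) (χ D x))) none) (m≤m+n _ _)
    arc-heavy {j = y} (_∷_ {y = x} _ (refl ∷ [])) _ ((x≢y ∷ []) ∷ _) fold with χ D y ℕ.≟ χ D x
    -- Equal labels on the two consecutive edges make the first a fold: 2 + 1.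
    ... | yes eq = +-mono-≤ (fold (here refl) x≢y eq) (≤-trans (1≤u y) (m≤m+n _ 0))
    -- With distinct labels, one of the two is not found outside, hence occurs only once, and its
    -- edge alone weighs 3.
    ... | no neq with any? (λ z → χ D x ℕ.≟ χ D z) out | any? (λ z → χ D y ℕ.≟ χ D z) out
    ...   | yes p | yes q = contradiction (s≤s (s≤s z≤n) , p ∷ q ∷ []) expensive
    ...   | no none | _   = ≤-trans (once x (≤-reflexive (cong₂ _+_ (δ-≡ {χ D x} refl) (cong (_+ 0) (δ-≢ (neq ∘ sym))))) none) (m≤m+n _ _)
    ...   | yes _ | no none = ≤-trans (once y (≤-reflexive (cong₂ _+_ (δ-≢ neq) (cong (_+ 0) (δ-≡ {χ D y} refl)))) none)
                                (≤-trans (m≤m+n _ 0) (m≤n+m _ (u x)))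
    arc-heavy (_∷_ {y = x} _ (_∷_ {y = y} _ (_∷_ {y = z} _ _))) _ _ _ =
      +-mono-≤ (1≤u x) (+-mono-≤ (1≤u y) (≤-trans (1≤u z) (m≤m+n _ _)))

-- Moves described by the cycles they touch

-- It follows that no old edge becomes a fold, the label of a new edge being fresh.
τ-old : ∀ D v w x → τ D v w (inj₁ x) ≡ inj₁ (nxt D x) ⊎ ∃[ n ] τ D v w (inj₁ x) ≡ inj₂ n
τ-old D v w x = stepOld-shape v w
  where
  stepW-shape : ∀ w → stepW D w x ≡ inj₁ (nxt D x) ⊎ ∃[ n ] stepW D w x ≡ inj₂ n
  stepW-shape vγ = inj₁ refl
  stepW-shape wγ = inj₁ refl
  stepW-shape (real j) with x ≟ j
  ... | yes _ = inj₂ (_ , refl)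
  ... | no  _ = inj₁ refl
  stepOld-shape : ∀ v w → stepOld D v w x ≡ inj₁ (nxt D x) ⊎ ∃[ n ] stepOld D v w x ≡ inj₂ n
  stepOld-shape vγ w = stepW-shape w
  stepOld-shape wγ w = stepW-shape w
  stepOld-shape (real i) w with x ≟ i
  ... | yes _ = inj₂ (_ , refl)
  ... | no  _ = stepW-shape w

-- Only the cycles met by the split vertices are described edge by edge: `arcs` and `news` make up
-- the cycles in `new`, and `dropped` is what is given up. The cells in `rest` keep their
-- successors, hence remain cycles of weight at least 4.
record Plan (D : BCS) (v w : Pt (m D)) : Set where
  field
    new       : List (List (E⁺ (m D)))
    arcs      : List (Fin (m D))
    dropped   : List (Fin (m D))
    rest      : List (List (Fin (m D)))
    news      : List NewEdge
    newCycles : All (Cyclic (τ D v w)) new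
    newEdges  : concat new ↭ map inj₁ arcs ++ map inj₂ news
    old       : arcs ++ dropped ++ concat rest ↭ allFin (m D)
    restCells : All (Cell D) rest
    untouched : ∀ {x} → x ∈ concat rest → τ D v w (inj₁ x) ≡ inj₁ (nxt D x)
    news!     : Unique news
    someNew   : ∃[ n ] n ∈ news
    echo      : All (λ x → Any (λ y → χ D x ≡ χ D y) (arcs ++ concat rest)) dropped

  private
    restCycle : ∀ {l} → l ∈ rest → Cyclic (τ D v w) (map inj₁ l)
    restCycle l∈ = cyclic (∈-map⁺ inj₁ (Cyclic.base∈ c))
      (lift (untouched (∈-concat⁺′ (Cyclic.base∈ c) l∈)) (λ x∈ → untouched (∈-concat⁺′ x∈ l∈)) (Cyclic.walk c))
      where
      c = Cell.isCycle (All.lookup restCells l∈)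
      lift : ∀ {x y l} → τ D v w (inj₁ x) ≡ inj₁ (nxt D x) → (∀ {z} → z ∈ l → τ D v w (inj₁ z) ≡ inj₁ (nxt D z)) →
             Walk (nxt D) x l y → Walk (τ D v w) (inj₁ x) (map inj₁ l) (inj₁ y)
      lift eq un []         = []
      lift eq un (refl ∷ w) = eq ∷ lift (un (here refl)) (un ∘ there) w

  surgery : Surgery D v w
  surgery = record
    { cells   = new ++ map (map inj₁) rest
    ; kept    = arcs ++ concat rest
    ; dropped = dropped
    ; news    = news
    ; cycles  = All.++⁺ newCycles (All.map⁺ (All.tabulate restCycle))
    ; old     = ↭-trans (↭-reflexive (++-assoc arcs (concat rest) dropped))
                        (↭-trans (↭.++⁺ˡ arcs (↭.++-comm (concat rest) dropped)) old)
    ; content = contents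
    ; news!   = news!
    ; someNew = someNew
    ; echo    = λ x∈ → let y , y∈ , eq = find (All.lookup echo x∈) in y , y∈ , eq
    }
    where
    contents : concat (new ++ map (map inj₁) rest) ↭ map inj₁ (arcs ++ concat rest) ++ map inj₂ news
    contents = ↭-trans (↭-reflexive (trans (sym (concat-++ new (map (map inj₁) rest))) (cong (concat new ++_) (concat-map rest))))
      (↭-trans (↭.++⁺ʳ (map inj₁ (concat rest)) newEdges)
      (↭-trans (↭-reflexive (++-assoc (map inj₁ arcs) (map inj₂ news) _))
      (↭-trans (↭.++⁺ˡ (map inj₁ arcs) (↭.++-comm (map inj₂ news) (map inj₁ (concat rest))))
      (↭-trans (↭-reflexive (sym (++-assoc (map inj₁ arcs) (map inj₁ (concat rest)) (map inj₂ news))))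
               (↭-reflexive (cong (_++ map inj₂ news) (sym (map-++ inj₁ arcs (concat rest)))))))))

  open Surgery surgery public using (result; weight⁺; edges; realizes; value-result; ΣΩ-result; partition-result; weight-untouched; bonus≤weight⁺)

  cells-length : length (Surgery.cells surgery) ≡ length new + length rest
  cells-length = trans (length-++ new) (cong (length new +_) (length-map _ rest))

  heavyCells : All (λ L → 4 ≤ Σ[ weight⁺ ] L) new → All (λ L → 4 ≤ Σ[ weight⁺ ] L) (Surgery.cells surgery)
  heavyCells heavy = All.++⁺ heavy (All.map⁺ (All.tabulate λ {l} l∈ →
    ≤-trans (Cell.heavy (All.lookup restCells l∈))
      (≤-trans (Σ-mono l (λ x∈ → weight-untouched (untouched (∈-concat⁺′ x∈ l∈)))) (≤-reflexive (sym (Σ-map weight⁺ inj₁ l))))))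

  inj₁∈edges : ∀ {x} → inj₁ x ∈ edges → x ∈ arcs ++ concat rest
  inj₁∈edges x∈ with ∈-++⁻ (map inj₁ (arcs ++ concat rest)) (↭.∈-resp-↭ (Surgery.content surgery) x∈)
  ... | inj₁ ∈₁ with _ , y∈ , refl ← ∈-map⁻ inj₁ ∈₁ = y∈
  ... | inj₂ ∈₂ with _ , _ , () ← ∈-map⁻ inj₂ ∈₂

  inj₂∈edges : ∀ {n} → inj₂ n ∈ edges → n ∈ news
  inj₂∈edges n∈ with ∈-++⁻ (map inj₁ (arcs ++ concat rest)) (↭.∈-resp-↭ (Surgery.content surgery) n∈)
  ... | inj₁ ∈₁ with _ , _ , () ← ∈-map⁻ inj₁ ∈₁
  ... | inj₂ ∈₂ with _ , k∈ , refl ← ∈-map⁻ inj₂ ∈₂ = k∈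

  keeps-all : dropped ≡ [] → 𝒇 ∈ news → 𝒇′ ∈ news → Realizes D v w Everything result
  keeps-all none f∈ f′∈ = realizes Everything (λ _ → tt) λ {e} _ → everything e
    where
    everything : ∀ e → e ∈ edges
    everything (inj₂ 𝒇)  = Surgery.new∈ surgery f∈
    everything (inj₂ 𝒇′) = Surgery.new∈ surgery f′∈
    everything (inj₁ x) with ∈-++⁻ (arcs ++ concat rest) (↭.∈-resp-↭ (↭-sym (Surgery.old surgery)) (∈-allFin x))
    ... | inj₁ x∈ = Surgery.old∈ surgery x∈
    ... | inj₂ x∈ with () ← subst (x ∈_) none x∈

  -- The dropped edges and `n` form the whole τ-cycle through `n`, so what is kept is exactly its
  -- complement.
  drops-cycle : ∀ {n} → n ∉ news → (∀ k → k ≡ n ⊎ k ∈ news) →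
                Walk (τ D v w) (inj₂ n) (map inj₁ dropped ++ inj₂ n ∷ []) (inj₂ n) →
                Realizes D v w (λ e → ¬ OnCycle (τ D v w) (inj₂ n) e) result
  drops-cycle {n} n∉ others walk = realizes _ (λ {e} e∈ on → disjoint e∈ (onCycle⇒∈ cyc n∈ on)) (λ {e} → cover e)
    where
    L = map inj₁ dropped ++ inj₂ n ∷ []
    n∈ : inj₂ n ∈ L
    n∈ = ∈-++⁺ʳ (map inj₁ dropped) (here refl)
    cyc : Cyclic (τ D v w) L
    cyc = cyclic n∈ walk
    disjoint : ∀ {e} → e ∈ edges → ¬ (e ∈ L)
    disjoint e∈ e∈L with ∈-++⁻ (map inj₁ dropped) e∈L
    ... | inj₂ (here refl) = n∉ (inj₂∈edges e∈)
    ... | inj₁ ∈₁ with x , x∈ , refl ← ∈-map⁻ inj₁ ∈₁ =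
      Unique-++-disjoint (arcs ++ concat rest) (Surgery.old! surgery) (inj₁∈edges e∈) x∈
    cover : ∀ e → ¬ OnCycle (τ D v w) (inj₂ n) e → e ∈ edges
    cover (inj₁ x) off with ∈-++⁻ (arcs ++ concat rest) (↭.∈-resp-↭ (↭-sym (Surgery.old surgery)) (∈-allFin x))
    ... | inj₁ x∈ = Surgery.old∈ surgery x∈
    ... | inj₂ x∈ = contradiction (walk⇒onCycle walk (∈-++⁺ˡ (∈-map⁺ inj₁ x∈))) off
    cover (inj₂ k) off with others k
    ... | inj₁ refl = contradiction (0 , refl) off
    ... | inj₂ k∈   = Surgery.new∈ surgery k∈

  weight-new : ∀ n → weight⁺ (inj₂ n) ≡ 1 + (bonus (length news) + δ (lab D (τ D v w (inj₂ n))) (lab D (inj₂ n)))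
  weight-new n = cong (λ o → 1 + (bonus o + _)) (trans (Σ-map (δ _) (lab D) (map inj₁ kept ++ map inj₂ news))
    (trans (Σ-++ (δ fresh ∘ lab D) (map inj₁ kept) (map inj₂ news))
           (cong₂ _+_ (trans (Σ-map _ inj₁ kept) (zeros kept)) (trans (Σ-map _ inj₂ news) (ones news)))))
    where
    kept  = arcs ++ concat rest
    fresh = lab D (inj₂ n)
    zeros : ∀ xs → Σ[ (λ x → δ fresh (χ D x)) ] xs ≡ 0
    zeros []       = refl
    zeros (x ∷ xs) = cong₂ _+_ (δ-≢ (fresh≢ {D} {x} {n})) (zeros xs)
    ones : ∀ ns → Σ[ (λ k → δ fresh (lab D (inj₂ k))) ] ns ≡ length ns
    ones []       = refl
    ones (k ∷ ns) = cong₂ _+_ (δ-≡ {fresh} refl) (ones ns)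

  -- Not a fold, so such an edge weighs 3 if it is the only new edge and 1 if both are present.
  weight-before-old : ∀ {n x} → τ D v w (inj₂ n) ≡ inj₁ x → weight⁺ (inj₂ n) ≡ 1 + bonus (length news)
  weight-before-old {n} {x} eq = trans (weight-new n) (cong (1 +_)
    (trans (cong (bonus (length news) +_) (trans (cong (λ e → δ (lab D e) (lab D (inj₂ n))) eq) (δ-≢ (fresh≢ {D} {x} {n} ∘ sym))))
           (+-identityʳ _)))

  -- A fold, so the weight is 4 for a lone loop and 2 if both new edges are present.
  weight-before-new : ∀ {n k} → τ D v w (inj₂ n) ≡ inj₂ k → weight⁺ (inj₂ n) ≡ 1 + (bonus (length news) + 1)
  weight-before-new {n} {k} eq = trans (weight-new n) (cong (λ d → 1 + (bonus (length news) + d))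
    (trans (cong (λ e → δ (lab D e) (lab D (inj₂ n))) eq) (δ-≡ {lab D (inj₂ n)} refl)))

  private
    fold≤ : ∀ x → δ (lab D (τ D v w (inj₁ x))) (χ D x) ≤ δ (χ D (nxt D x)) (χ D x)
    fold≤ x with τ-old D v w x
    ... | inj₁ eq       = ≤-reflexive (cong (λ e → δ (lab D e) (χ D x)) eq)
    ... | inj₂ (n , eq) = ≤-trans (≤-reflexive (trans (cong (λ e → δ (lab D e) (χ D x)) eq) (δ-≢ (fresh≢ {D} {x} {n})))) z≤n

  Ω-bound : Ω result ≤ Σ[ ω D ] (arcs ++ concat rest) + 2 * length dropped + Σ[ weight⁺ ∘ inj₂ ] news
  Ω-bound = ≤-trans (≤-reflexive (sym (+-identityʳ _))) (ΣΩ-result 0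
    (≤-trans (≤-reflexive (+-identityʳ _)) (Σ-mono (arcs ++ concat rest) (λ {x} _ → fold≤ x))))

  -- The edge `k` is now followed by a fresh label, so a fold at `k` is destroyed and its weight
  -- saved.
  Ω-bound-cut : ∀ {k n} → k ∈ arcs → τ D v w (inj₁ k) ≡ inj₂ n →
                Ω result + δ (χ D (nxt D k)) (χ D k) ≤
                Σ[ ω D ] (arcs ++ concat rest) + 2 * length dropped + Σ[ weight⁺ ∘ inj₂ ] news
  Ω-bound-cut {k} {n} k∈ cut = ΣΩ-result _ (Σ-mono-at (arcs ++ concat rest) fold≤ (∈-++⁺ˡ k∈)
    (≤-reflexive (cong (_+ _) (trans (cong (λ e → δ (lab D e) (χ D k)) cut) (δ-≢ (fresh≢ {D} {k} {n}))))))

  Ω-total : Σ[ ω D ] (arcs ++ concat rest) + Σ[ ω D ] dropped ≡ Ω D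
  Ω-total = trans (sym (Σ-++ (ω D) (arcs ++ concat rest) dropped)) (Σ-↭ (ω D) (Surgery.old surgery))

  all-new : ¬ Fin (m D) → ∀ x y → χ result x ≡ χ result y
  all-new none x y = trans (lab≡ (Surgery.h surgery x)) (sym (lab≡ (Surgery.h surgery y)))
    where
    lab≡ : ∀ e → lab D e ≡ lab D (inj₂ 𝒇)
    lab≡ (inj₁ x) = contradiction x none
    lab≡ (inj₂ _) = refl

-- The later argument uses the new position only through these properties. `partition` fixes the
-- number of cycles, which enters the inequality.
record Outcome {D : BCS} {v w : Pt (m D)} (P : Plan D v w) : Set where
  open Plan P using (new; arcs; dropped; rest; news; weight⁺)
  field
    result      : BCS
    grows       : valueD D < valueD result
    partition   : ∃[ ls ] All (Cell result) ls × concat ls ↭ allFin (m result) × length ls ≡ length new + length rest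
    bound       : Ω result ≤ Σ[ ω D ] (arcs ++ concat rest) + 2 * length dropped + Σ[ weight⁺ ∘ inj₂ ] news
    bound-cut   : ∀ {k n} → k ∈ arcs → τ D v w (inj₁ k) ≡ inj₂ n →
                  Ω result + δ (χ D (nxt D k)) (χ D k) ≤
                  Σ[ ω D ] (arcs ++ concat rest) + 2 * length dropped + Σ[ weight⁺ ∘ inj₂ ] news
    keeps-all   : dropped ≡ [] → 𝒇 ∈ news → 𝒇′ ∈ news → Realizes D v w Everything result
    drops-cycle : ∀ {n} → n ∉ news → (∀ k → k ≡ n ⊎ k ∈ news) →
                  Walk (τ D v w) (inj₂ n) (map inj₁ dropped ++ inj₂ n ∷ []) (inj₂ n) →
                  Realizes D v w (λ e → ¬ OnCycle (τ D v w) (inj₂ n) e) result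
    all-new     : ¬ Fin (m D) → ∀ x y → χ result x ≡ χ result y

opaque
  outcome : ∀ {D v w} (P : Plan D v w) → All (λ L → 4 ≤ Σ[ Plan.weight⁺ P ] L) (Plan.new P) → Outcome P
  outcome P heavy = record
    { result      = result
    ; grows       = value-result
    ; partition   = let ls , cs , cover , len = partition-result (heavyCells heavy) in ls , cs , cover , trans len cells-length
    ; bound       = Ω-bound
    ; bound-cut   = Ω-bound-cut
    ; keeps-all   = keeps-all
    ; drops-cycle = drops-cycle
    ; all-new     = all-new
    }
    where open Plan P

-- The inequality that Cutter maintains

Margin : ℕ → BCS → ℕ → ℕ → ℕ → Set
Margin g₀ D g c k = Ω D + k + 8 * g₀ ≤ 6 * valueD D + 4 * c + 8 * g

-- The position after the first move.
Fresh : BCS → ℕ → Set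
Fresh D c = (∀ x → χ D (nxt D x) ≡ χ D x) × Ω D ≤ 4 × c ≡ 1

-- After the first move only the smaller margin holds; the second move makes up for the difference by
-- destroying a fold or by adding a cycle.
Stage : ℕ → BCS → ℕ → ℕ → Set
Stage g₀ D g c = Margin g₀ D g c 10 ⊎ Fresh D c × Margin g₀ D g c 6

record Invariant (g₀ : ℕ) (D : BCS) (g : ℕ) : Set where
  field
    cycles : List (List (Fin (m D)))
    cells  : All (Cell D) cycles
    cover  : concat cycles ↭ allFin (m D)
    stage  : Stage g₀ D g (length cycles)

record Response (g₀ : ℕ) (γ : GameState) (v w : Pt (m (D γ))) : Set where
  field
    reply     : GameState
    move      : Move γ v w reply
    grows     : valueD (D γ) < valueD (D reply)
    invariant : Invariant g₀ (D reply) (g reply)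

-- A new label adds 6 to the right-hand side. The second inequality says that the growth of the
-- weight, lost cycles and spent counter, net of any cycle gained, use up at most `6 - l` of this;
-- the remaining `l` raises the constant from `k` to `n`.
margin-step : ∀ Ω₁ Ω₂ k l n G v₁ v₂ c₁ c₂ g₁ g₂ → k + l ≡ n →
              Ω₁ + k + G ≤ 6 * v₁ + 4 * c₁ + 8 * g₁ →
              Ω₂ + l + 4 * c₁ + 8 * g₁ ≤ Ω₁ + 6 + 4 * c₂ + 8 * g₂ → v₁ < v₂ →
              Ω₂ + n + G ≤ 6 * v₂ + 4 * c₂ + 8 * g₂
-- The hypotheses are added up and the common terms cancelled.
margin-step Ω₁ Ω₂ k l n G v₁ v₂ c₁ c₂ g₁ g₂ refl margin gain v< = +-cancelˡ-≤ (Ω₁ + 6 * suc v₁ + 4 * c₁ + 8 * g₁) _ _ (begin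
  Ω₁ + 6 * suc v₁ + 4 * c₁ + 8 * g₁ + (Ω₂ + (k + l) + G)
    ≡⟨ solve 8 (λ Ω₁ Ω₂ k l G v₁ c₁ g₁ →
         Ω₁ :+ con 6 :* (con 1 :+ v₁) :+ con 4 :* c₁ :+ con 8 :* g₁ :+ (Ω₂ :+ (k :+ l) :+ G)
         := (Ω₁ :+ k :+ G) :+ (Ω₂ :+ l :+ con 4 :* c₁ :+ con 8 :* g₁) :+ con 6 :* (con 1 :+ v₁)) refl Ω₁ Ω₂ k l G v₁ c₁ g₁ ⟩
  (Ω₁ + k + G) + (Ω₂ + l + 4 * c₁ + 8 * g₁) + 6 * suc v₁
    ≤⟨ +-mono-≤ (+-mono-≤ margin gain) (*-monoʳ-≤ 6 v<) ⟩
  (6 * v₁ + 4 * c₁ + 8 * g₁) + (Ω₁ + 6 + 4 * c₂ + 8 * g₂) + 6 * v₂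
    ≡⟨ solve 7 (λ Ω₁ v₁ v₂ c₁ c₂ g₁ g₂ →
         (con 6 :* v₁ :+ con 4 :* c₁ :+ con 8 :* g₁) :+ (Ω₁ :+ con 6 :+ con 4 :* c₂ :+ con 8 :* g₂) :+ con 6 :* v₂
         := Ω₁ :+ con 6 :* (con 1 :+ v₁) :+ con 4 :* c₁ :+ con 8 :* g₁ :+ (con 6 :* v₂ :+ con 4 :* c₂ :+ con 8 :* g₂)) refl Ω₁ v₁ v₂ c₁ c₂ g₁ g₂ ⟩
  Ω₁ + 6 * suc v₁ + 4 * c₁ + 8 * g₁ + (6 * v₂ + 4 * c₂ + 8 * g₂) ∎)
  where
  open ≤-Reasoning
  open +-*-Solver using (solve; _:+_; _:*_; _:=_; con)

module _ {D : BCS} {v w : Pt (m D)} {P : Plan D v w} (O : Outcome P) where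
  open Plan P using (new; rest)
  open Outcome O

  Gain : ℕ → ℕ → ℕ → ℕ → Set
  Gain c g g′ k = Ω result + k + 4 * c + 8 * g ≤ Ω D + 6 + 4 * (length new + length rest) + 8 * g′

  invariant⁺ : ∀ {g₀ g′} → Stage g₀ result g′ (length new + length rest) → Invariant g₀ result g′
  invariant⁺ {g₀} {g′} st = let ls , cs , cover , len = partition in record
    { cycles = ls ; cells = cs ; cover = cover ; stage  = subst (Stage g₀ result g′) (sym len) st }

  -- The constant 10 survives a gain of 0; raising 6 to 10 takes a gain of 4.
  advance : ∀ {g₀ g g′ c} → Stage g₀ D g c → Gain c g g′ 0 → (Fresh D c → Gain c g g′ 4) → Invariant g₀ result g′
  advance {g₀} {g} {g′} {c} (inj₁ margin) gain _ = invariant⁺ (inj₁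
    (margin-step (Ω D) (Ω result) 10 0 10 (8 * g₀) (valueD D) (valueD result) c (length new + length rest) g g′ refl margin gain grows))
  advance {g₀} {g} {g′} {c} (inj₂ (fresh , margin)) _ gain = invariant⁺ (inj₁
    (margin-step (Ω D) (Ω result) 6 4 10 (8 * g₀) (valueD D) (valueD result) c (length new + length rest) g g′ refl margin (gain fresh) grows))

-- Choices of dummy vertices only

NoReal : ∀ {n} → Pt n → Set
NoReal (real _) = ⊥
NoReal _        = ⊤

loopPlan : ∀ {D v w} ns ls → All (Cell D) ls → concat ls ↭ allFin (m D) →
           (∀ x → τ D v w (inj₁ x) ≡ inj₁ (nxt D x)) → Unique ns → (∃[ n ] n ∈ ns) →
           Cyclic (τ D v w) (map inj₂ ns) → Plan D v w
loopPlan ns ls cs cover off ns! some cyc = record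
  { new = map inj₂ ns ∷ [] ; arcs = [] ; dropped = [] ; rest = ls ; news = ns
  ; newCycles = cyc ∷ [] ; newEdges = ↭-reflexive (++-identityʳ _) ; old = cover ; restCells = cs
  ; untouched = λ {x} _ → off x ; news! = ns! ; someNew = some ; echo = [] }

record Loops (γ : GameState) (v w : Pt (m (D γ))) (ls : List (List (Fin (m (D γ))))) : Set where
  field
    {plan} : Plan (D γ) v w
    made   : Outcome plan
  open Outcome made public
  field
    count  : length (Plan.new plan) + length (Plan.rest plan) ≡ suc (length ls)
    Ω≤     : Ω result ≤ Ω (D γ) + 4
    move   : Move γ v w (record { D = result ; g = g γ })

module _ (γ : GameState) (ls : List (List (Fin (m (D γ))))) (cs : All (Cell (D γ)) ls) (cover : concat ls ↭ allFin (m (D γ))) where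

  -- The new edges form a cycle of their own, of weight 4: a lone loop weighs 1 + 2 + 1, and each
  -- edge of a 2-cycle weighs 1 + 1.
  loopsWith : ∀ {v w} (off : ∀ x → τ (D γ) v w (inj₁ x) ≡ inj₁ (nxt (D γ) x)) ns (ns! : Unique ns) (some : ∃[ n ] n ∈ ns)
              (cyc : Cyclic (τ (D γ) v w) (map inj₂ ns)) → (∀ {n} → n ∈ ns → ∃[ k ] τ (D γ) v w (inj₂ n) ≡ inj₂ k) →
              Σ[ (λ _ → 1 + (bonus (length ns) + 1)) ] ns ≡ 4 →
              ((O : Outcome (loopPlan {v = v} {w} ns ls cs cover off ns! some cyc)) →
               Move γ v w (record { D = Outcome.result O ; g = g γ })) →
              Loops γ v w ls
  loopsWith {v} {w} off ns ns! some cyc new→new four mv = record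
    { made  = O
    ; count = refl
    ; Ω≤    = ≤-trans (Outcome.bound O) (≤-reflexive (cong₂ _+_ (trans (+-identityʳ _) (Σ-↭ (ω (D γ)) cover)) Σ≡4))
    ; move  = mv O }
    where
    P = loopPlan {v = v} {w} ns ls cs cover off ns! some cyc
    Σ≡4 : Σ[ Plan.weight⁺ P ∘ inj₂ ] ns ≡ 4
    Σ≡4 = trans (Σ-cong ns (λ {n} n∈ → Plan.weight-before-new P {n} (proj₂ (new→new n∈)))) four
    O = outcome P (≤-reflexive (sym (trans (Σ-map (Plan.weight⁺ P) inj₂ ns) Σ≡4)) ∷ [])

  loops : ∀ v w → NoReal v → NoReal w → Loops γ v w ls
  -- Both new edges are loops with the same label; `𝒇′` is discarded.
  loops vγ vγ _ _ = loopsWith (λ _ → refl) (𝒇 ∷ []) ([] ∷ []) (𝒇 , here refl) (cyclic (here refl) (refl ∷ []))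
    (λ { (here refl) → 𝒇 , refl }) refl
    (λ O → moveB tt (Outcome.drops-cycle O (λ { (here ()) }) (λ { 𝒇 → inj₂ (here refl) ; 𝒇′ → inj₁ refl }) (refl ∷ [])) refl)
  loops wγ wγ _ _ = loopsWith (λ _ → refl) (𝒇 ∷ []) ([] ∷ []) (𝒇 , here refl) (cyclic (here refl) (refl ∷ []))
    (λ { (here refl) → 𝒇 , refl }) refl
    (λ O → moveB tt (Outcome.drops-cycle O (λ { (here ()) }) (λ { 𝒇 → inj₂ (here refl) ; 𝒇′ → inj₁ refl }) (refl ∷ [])) refl)
  loops vγ wγ _ _ = loopsWith (λ _ → refl) (𝒇′ ∷ 𝒇 ∷ []) (((λ ()) ∷ []) ∷ [] ∷ []) (𝒇′ , here refl)
    (cyclic (there (here refl)) (refl ∷ refl ∷ [])) (λ { (here refl) → 𝒇 , refl ; (there (here refl)) → 𝒇′ , refl }) refl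
    (λ O → moveD (λ ()) (Outcome.keeps-all O refl (there (here refl)) (here refl)) refl)
  loops wγ vγ _ _ = loopsWith (λ _ → refl) (𝒇′ ∷ 𝒇 ∷ []) (((λ ()) ∷ []) ∷ [] ∷ []) (𝒇′ , here refl)
    (cyclic (there (here refl)) (refl ∷ refl ∷ [])) (λ { (here refl) → 𝒇 , refl ; (there (here refl)) → 𝒇′ , refl }) refl
    (λ O → moveD (λ ()) (Outcome.keeps-all O refl (there (here refl)) (here refl)) refl)

-- Changing a single cycle

-- Covers the insertion of new edges at one vertex as well as the case where one of the two arcs is dropped.
module OneCell {D : BCS} {v w : Pt (m D)} {j : Fin (m D)} (arc dropped : List (Fin (m D))) (rest : List (List (Fin (m D))))
  (cover : arc ++ dropped ++ concat rest ↭ allFin (m D)) (cells : All (Cell D) rest)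
  (untouched : ∀ {x} → x ∈ concat rest → τ D v w (inj₁ x) ≡ inj₁ (nxt D x))
  (echo : All (λ x → Any (λ y → χ D x ≡ χ D y) (arc ++ concat rest)) dropped)
  (ns : List NewEdge) (ns! : Unique ns) (some : ∃[ n ] n ∈ ns)
  (cyc : Cyclic (τ D v w) (map inj₁ arc ++ map inj₂ ns)) (j∈ : j ∈ arc) {cut : NewEdge} (at-j : τ D v w (inj₁ j) ≡ inj₂ cut) where

  plan : Plan D v w
  plan = record
    { new = (map inj₁ arc ++ map inj₂ ns) ∷ [] ; arcs = arc ; dropped = dropped ; rest = rest ; news = ns
    ; newCycles = cyc ∷ [] ; newEdges = ↭-reflexive (++-identityʳ _) ; old = cover ; restCells = cells
    ; untouched = untouched ; news! = ns! ; someNew = some ; echo = echo }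

  -- The weight 3 arises in two ways: from a lone new edge before an old one, or from a pair whose
  -- first edge, a fold, weighs 2 and whose second weighs 1.
  module _ (Σ≡3 : Σ[ Plan.weight⁺ plan ∘ inj₂ ] ns ≡ 3) where
    open Plan plan using (weight⁺; Ω-total)

    made : Outcome plan
    -- The arc contributes at least one edge, and 1 + 3 is the required 4.
    made = outcome plan (≤-trans (+-mono-≤ 1≤arc (≤-reflexive (sym Σ≡3)))
      (≤-reflexive (sym (trans (Σ-++ weight⁺ (map inj₁ arc) (map inj₂ ns))
                               (cong₂ _+_ (Σ-map weight⁺ inj₁ arc) (Σ-map weight⁺ inj₂ ns))))) ∷ [])
      where
      1≤arc : 1 ≤ Σ[ weight⁺ ∘ inj₁ ] arc
      1≤arc = ≤-trans (∈-length j∈) (length≤Σ _ arc (λ _ → s≤s z≤n))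

    open Outcome made

    module _ (short : length dropped ≤ 2) where

      private
        K = Σ[ ω D ] (arc ++ concat rest)
        d = length dropped

        -- `K` and `B` are the weights of the kept and of the dropped old edges, and `s` is the
        -- weight saved by destroying a fold.
        gain : ∀ s k B → K + B ≡ Ω D → Ω result + s ≤ K + 2 * d + 3 → 2 * d + k ≤ B + (3 + s) → Ω result + k ≤ Ω D + 6
        gain s k B total bnd le = +-cancelˡ-≤ s _ _ (begin
          s + (Ω result + k)    ≡⟨ solve 3 (λ s o k → s :+ (o :+ k) := (o :+ s) :+ k) refl s (Ω result) k ⟩
          (Ω result + s) + k    ≤⟨ +-monoˡ-≤ k bnd ⟩
          K + 2 * d + 3 + k     ≡⟨ solve 3 (λ a d k → a :+ con 2 :* d :+ con 3 :+ k := a :+ (con 2 :* d :+ k) :+ con 3) refl K d k ⟩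
          K + (2 * d + k) + 3   ≤⟨ +-monoˡ-≤ 3 (+-monoʳ-≤ K le) ⟩
          K + (B + (3 + s)) + 3 ≡⟨ solve 3 (λ a b s → a :+ (b :+ (con 3 :+ s)) :+ con 3 := s :+ ((a :+ b) :+ con 6)) refl K B s ⟩
          s + (K + B + 6)       ≡⟨ cong (λ o → s + (o + 6)) total ⟩
          s + (Ω D + 6)         ∎)
          where
          open ≤-Reasoning
          open +-*-Solver using (solve; _:+_; _:*_; _:=_; con)

        bound′ = ≤-trans (bound-cut j∈ at-j) (≤-reflexive (cong (K + 2 * d +_) Σ≡3))

      -- A dropped edge costs 2 but takes weight at least 1 with it. With at most two of them `Ω`
      -- rises by at most 3 + 2, within the 6 earned by the new label.
      gain₀ : Ω result + 0 ≤ Ω D + 6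
      gain₀ = gain 0 0 (Σ[ ω D ] dropped) Ω-total
        (≤-trans (≤-trans (≤-reflexive (+-identityʳ _)) (m≤m+n _ _)) bound′)
        (≤-trans (≤-reflexive (+-identityʳ (2 * d)))
          (+-mono-≤ (length≤Σ (ω D) dropped (1≤ω {D})) (≤-trans (≤-reflexive (+-identityʳ d)) (≤-trans short (n≤1+n 2)))))

      -- If all edges are folds, a dropped edge takes weight at least 2 with it, which pays for its
      -- cost, and the cut destroys the fold at `j`. So `Ω` rises by at most 3 - 1, and 4 of the 6
      -- are left.
      gain₄ : (∀ x → χ D (nxt D x) ≡ χ D x) → Ω result + 4 ≤ Ω D + 6
      gain₄ folds = gain 1 4 (Σ[ ω D ] dropped) Ω-total
        (≤-trans (≤-reflexive (cong (Ω result +_) (sym (δ-≡ (folds j))))) bound′)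
        (+-monoˡ-≤ 4 (2*length≤Σ dropped))
        where
        2*length≤Σ : ∀ xs → 2 * length xs ≤ Σ[ ω D ] xs
        2*length≤Σ []       = z≤n
        2*length≤Σ (x ∷ xs) = ≤-trans (≤-reflexive (*-distribˡ-+ 2 1 (length xs))) (+-mono-≤ (fold⇒2≤ω D (folds x)) (2*length≤Σ xs))

      respond : ∀ {g₀ g c} → c ≡ suc (length rest) → Stage g₀ D g c → Invariant g₀ result g
      respond {g = g} refl st = advance made {g = g} {g} st (pad gain₀) (λ fresh → pad (gain₄ (proj₁ fresh)))
        where
        pad : ∀ {k} → Ω result + k ≤ Ω D + 6 → Gain made (suc (length rest)) g g k
        pad le = +-monoˡ-≤ (8 * g) (+-monoˡ-≤ (4 * suc (length rest)) le)

-- The successor map at and off the split vertices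

stepW-at : ∀ D j → stepW D (real j) j ≡ inj₂ 𝒇
stepW-at D j with j ≟ j
... | yes _  = refl
... | no j≢j = contradiction refl j≢j

stepW-off : ∀ D {j x} → x ≢ j → stepW D (real j) x ≡ inj₁ (nxt D x)
stepW-off D {j} {x} x≢j with x ≟ j
... | yes x≡j = contradiction x≡j x≢j
... | no  _   = refl

stepOld-at : ∀ D i w → stepOld D (real i) w i ≡ inj₂ 𝒇′
stepOld-at D i w with i ≟ i
... | yes _  = refl
... | no i≢i = contradiction refl i≢i

stepOld-off : ∀ D {i} w {x} → x ≢ i → stepOld D (real i) w x ≡ stepW D w x
stepOld-off D {i} w {x} x≢i with x ≟ i
... | yes x≡i = contradiction x≡i x≢i
... | no  _   = refl

stepF-same : ∀ D i → stepF D (real i) (real i) ≡ inj₂ 𝒇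
stepF-same D i with i ≟ i
... | yes _  = refl
... | no i≢i = contradiction refl i≢i

stepF-distinct : ∀ D {i j} → i ≢ j → stepF D (real i) (real j) ≡ inj₁ (nxt D i)
stepF-distinct D {i} {j} i≢j with i ≟ j
... | yes i≡j = contradiction i≡j i≢j
... | no  _   = refl

∈⇒≢[] : ∀ {A : Set} {x : A} {xs} → x ∈ xs → xs ≢ []
∈⇒≢[] () refl

-- Replies to the choices of Marker

record Focus (D : BCS) (ls : List (List (Fin (m D)))) (i : Fin (m D)) : Set where
  field
    {cycle} : List (Fin (m D))
    {rest}  : List (List (Fin (m D)))
    walk    : Walk (nxt D) i cycle i
    i∈      : i ∈ cycle
    cells   : All (Cell D) rest
    cover   : cycle ++ concat rest ↭ allFin (m D)
    count   : length ls ≡ suc (length rest)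

  uniq : Unique (cycle ++ concat rest)
  uniq = Unique-resp-↭ (↭-sym cover) (Unique.allFin⁺ _)

  i∉rest : i ∉ concat rest
  i∉rest = Unique-++-disjoint cycle uniq i∈

module _ (g₀ : ℕ) (γ : GameState) (inv : Invariant g₀ (D γ) (g γ)) where
  open Invariant inv using (cycles; cells; cover; stage)

  private
    G = D γ

  focusOn : ∀ i → Focus G cycles i
  focusOn i = let l , ρ , walk , i∈ , cs , p , count = focus cycles cells (↭.∈-resp-↭ (↭-sym cover) (∈-allFin i)) in
    record { walk = walk ; i∈ = i∈ ; cells = cs ; cover = ↭-trans (↭-sym p) cover ; count = count }

  respond-dummies : ∀ v w → NoReal v → NoReal w → Response g₀ γ v w
  respond-dummies v w nv nw = record
    { reply = _ ; move = move ; grows = grows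
    ; invariant = advance made {g = g γ} {g γ} stage (gain z≤n) (λ _ → gain (s≤s (s≤s (s≤s (s≤s z≤n))))) }
    where
    open Loops {γ} {v} {w} (loops γ cycles cells cover v w nv nw)
    gain : ∀ {k} → k ≤ 4 → Gain made (length cycles) (g γ) (g γ) k
    gain {k} k≤ = +-monoˡ-≤ (8 * g γ) (begin
      Ω result + k + 4 * length cycles     ≤⟨ +-monoˡ-≤ (4 * length cycles) (+-mono-≤ Ω≤ k≤) ⟩
      -- The extra cycle is worth 4, which is what its weight costs, so the 6 from the new label
      -- remain; `k` takes at most 4 of them, whence the slack 2.
      Ω G + 4 + 4 + 4 * length cycles      ≤⟨ m≤n+m _ 2 ⟩
      2 + (Ω G + 4 + 4 + 4 * length cycles)
        ≡⟨ solve 2 (λ o c → con 2 :+ (o :+ con 4 :+ con 4 :+ con 4 :* c) := o :+ con 6 :+ con 4 :* (con 1 :+ c)) refl (Ω G) (length cycles) ⟩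
      Ω G + 6 + 4 * suc (length cycles)    ≡⟨ cong (λ c → Ω G + 6 + 4 * c) (sym count) ⟩
      Ω G + 6 + 4 * (length (Plan.new plan) + length (Plan.rest plan)) ∎)
      where
      open ≤-Reasoning
      open +-*-Solver using (solve; _:+_; _:*_; _:=_; con)

  -- n₁ and n₂ are inserted, in this order, at the vertex i.
  insert-pair : ∀ {v w} i n₁ n₂ → n₁ ≢ n₂ → 𝒇 ∈ n₁ ∷ n₂ ∷ [] → 𝒇′ ∈ n₁ ∷ n₂ ∷ [] → ¬ SameComp G v w →
                τ G v w (inj₁ i) ≡ inj₂ n₁ → τ G v w (inj₂ n₁) ≡ inj₂ n₂ → τ G v w (inj₂ n₂) ≡ inj₁ (nxt G i) →
                (∀ {x} → x ≢ i → τ G v w (inj₁ x) ≡ inj₁ (nxt G x)) → Response g₀ γ v w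
  insert-pair {v} {w} i n₁ n₂ n₁≢n₂ f∈ f′∈ apart at n₁→n₂ n₂→ off = record
    { reply = _ ; move = moveD apart (Outcome.keeps-all made refl f∈ f′∈) refl ; grows = Outcome.grows made
    ; invariant = C.respond Σ≡3 z≤n count stage }
    where
    module F = Focus (focusOn i)
    open F using (cycle; rest; i∈; count; uniq; i∉rest)
    ns = n₁ ∷ n₂ ∷ []
    ns! : Unique ns
    ns! = (n₁≢n₂ ∷ []) ∷ [] ∷ []
    untouched : ∀ {x} → x ∈ concat rest → τ G v w (inj₁ x) ≡ inj₁ (nxt G x)
    untouched x∈ = off (λ { refl → i∉rest x∈ })
    cyc : Cyclic (τ G v w) (map inj₁ cycle ++ map inj₂ ns)
    cyc = cyclic (∈-++⁺ʳ (map inj₁ cycle) (there (here refl)))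
      (walk-map inj₁ F.walk (∈⇒≢[] i∈) (Unique-++ˡ cycle uniq) (λ _ → off) n₂→ ++ʷ (at ∷ n₁→n₂ ∷ []))
    module C = OneCell {v = v} {w} cycle [] rest F.cover F.cells untouched [] ns ns! (n₁ , here refl) cyc i∈ at
    Σ≡3 : Σ[ Plan.weight⁺ C.plan ∘ inj₂ ] ns ≡ 3
    Σ≡3 = cong₂ (λ a b → a + (b + 0)) (Plan.weight-before-new C.plan {n₁} n₁→n₂) (Plan.weight-before-old C.plan {n₂} n₂→)
    made = C.made Σ≡3

  -- By the convention for a vertex chosen twice, `𝒇` is a loop and `𝒇′` is inserted at `i`. The
  -- loop is discarded; it carries no old label.
  respond-same : ∀ i → Response g₀ γ (real i) (real i)
  respond-same i = record
    { reply = _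
    ; move = moveC (0 , refl) (Outcome.drops-cycle made (λ { (here ()) }) (λ { 𝒇 → inj₁ refl ; 𝒇′ → inj₂ (here refl) })
                                 (stepF-same G i ∷ [])) refl
    ; grows = Outcome.grows made
    ; invariant = C.respond Σ≡3 z≤n count stage }
    where
    v = real i
    module F = Focus (focusOn i)
    open F using (cycle; rest; i∈; count; uniq; i∉rest)
    ns = 𝒇′ ∷ []
    off : ∀ {x} → x ≢ i → τ G v v (inj₁ x) ≡ inj₁ (nxt G x)
    off x≢i = trans (stepOld-off G v x≢i) (stepW-off G x≢i)
    untouched : ∀ {x} → x ∈ concat rest → τ G v v (inj₁ x) ≡ inj₁ (nxt G x)
    untouched x∈ = off (λ { refl → i∉rest x∈ })
    cyc : Cyclic (τ G v v) (map inj₁ cycle ++ map inj₂ ns)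
    cyc = cyclic (∈-++⁺ʳ (map inj₁ cycle) (here refl))
      (walk-map inj₁ F.walk (∈⇒≢[] i∈) (Unique-++ˡ cycle uniq) (λ _ → off) refl ++ʷ (stepOld-at G i v ∷ []))
    module C = OneCell {v = v} {v} cycle [] rest F.cover F.cells untouched [] ns ([] ∷ []) (𝒇′ , here refl) cyc i∈ (stepOld-at G i v)
    Σ≡3 : Σ[ Plan.weight⁺ C.plan ∘ inj₂ ] ns ≡ 3
    Σ≡3 = cong (_+ 0) (Plan.weight-before-old C.plan {𝒇′} refl)
    made = C.made Σ≡3

  module Distinct {i j : Fin (m (D γ))} (i≢j : i ≢ j) where

    private
      v w : Pt (m G)
      v = real i
      w = real j
      module F = Focus (focusOn i)
      open F using (cycle; rest; i∈; count; uniq)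

      T = τ G v w

      at-i : T (inj₁ i) ≡ inj₂ 𝒇′
      at-i = stepOld-at G i w

      at-j : T (inj₁ j) ≡ inj₂ 𝒇
      at-j = trans (stepOld-off G w (i≢j ∘ sym)) (stepW-at G j)

      off : ∀ {x} → x ≢ i → x ≢ j → T (inj₁ x) ≡ inj₁ (nxt G x)
      off x≢i x≢j = trans (stepOld-off G w x≢i) (stepW-off G x≢j)

      f→ : T (inj₂ 𝒇) ≡ inj₁ (nxt G i)
      f→ = stepF-distinct G i≢j

    -- Losing a cycle costs 4 and the two new edges weigh 1 each, which is exactly the 6 earned. The
    -- stage after the first move is excluded, as it has a single cycle.
    merge : j ∉ cycle → Response g₀ γ v w
    merge j∉ with ∈-++⁻ cycle (↭.∈-resp-↭ (↭-sym F.cover) (∈-allFin j))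
    ... | inj₁ j∈ = contradiction j∈ j∉
    ... | inj₂ j∈ with focus rest F.cells j∈
    ... | cycle′ , rest′ , walk′ , j∈′ , cells′ , p , count′ = record
      { reply = _
      ; move = moveD (λ on → j∉ (onCycle⇒∈ (cyclic i∈ F.walk) i∈ on)) (Outcome.keeps-all made refl (there (here refl)) (here refl)) refl
      ; grows = Outcome.grows made
      ; invariant = advance made {g = g γ} {g γ} stage gain
          (λ (_ , _ , c≡1) → contradiction (trans (sym c≡1) (trans count (cong suc count′))) λ ()) }
      where
      cover′ : cycle ++ cycle′ ++ concat rest′ ↭ allFin (m G)
      cover′ = ↭-trans (↭.++⁺ˡ cycle (↭-sym p)) F.cover
      uniq′ : Unique (cycle ++ cycle′ ++ concat rest′)
      uniq′ = Unique-resp-↭ (↭-sym cover′) (Unique.allFin⁺ _)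
      i∉′ : i ∉ cycle′ ++ concat rest′
      i∉′ = Unique-++-disjoint cycle uniq′ i∈
      j∉′ : j ∉ concat rest′
      j∉′ = Unique-++-disjoint cycle′ (Unique-++ʳ cycle uniq′) j∈′
      L = map inj₁ cycle ++ inj₂ 𝒇′ ∷ (map inj₁ cycle′ ++ inj₂ 𝒇 ∷ [])
      walkL : Walk T (inj₂ 𝒇) L (inj₂ 𝒇)
      walkL = walk-map inj₁ F.walk (∈⇒≢[] i∈) (Unique-++ˡ cycle uniq)
                (λ y∈ y≢i → off y≢i (λ { refl → j∉ y∈ })) f→
        ++ʷ (at-i ∷ (walk-map inj₁ walk′ (∈⇒≢[] j∈′) (Unique-++ˡ cycle′ (Unique-++ʳ cycle uniq′))
                (λ y∈ y≢j → off (λ { refl → i∉′ (∈-++⁺ˡ y∈) }) y≢j) refl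
        ++ʷ (at-j ∷ [])))
      plan : Plan G v w
      plan = record
        { new = L ∷ [] ; arcs = cycle ++ cycle′ ; dropped = [] ; rest = rest′ ; news = 𝒇′ ∷ 𝒇 ∷ []
        ; newCycles = cyclic (∈-++⁺ʳ (map inj₁ cycle) (there (∈-++⁺ʳ (map inj₁ cycle′) (here refl)))) walkL ∷ []
        ; newEdges = ↭-trans (↭-reflexive (++-identityʳ L))
            (↭-trans (↭.++⁺ˡ (map inj₁ cycle) (↭.shifts (inj₂ 𝒇′ ∷ []) (map inj₁ cycle′)))
            (↭-reflexive (trans (sym (++-assoc (map inj₁ cycle) (map inj₁ cycle′) (inj₂ 𝒇′ ∷ inj₂ 𝒇 ∷ [])))
                                (cong (_++ inj₂ 𝒇′ ∷ inj₂ 𝒇 ∷ []) (sym (map-++ inj₁ cycle cycle′))))))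
        ; old = ↭-trans (↭-reflexive (++-assoc cycle cycle′ (concat rest′))) cover′ ; restCells = cells′
        ; untouched = λ x∈ → off (λ { refl → i∉′ (∈-++⁺ʳ cycle′ x∈) }) (λ { refl → j∉′ x∈ })
        ; news! = ((λ ()) ∷ []) ∷ [] ∷ [] ; someNew = 𝒇 , there (here refl) ; echo = [] }
      open Plan plan using (weight⁺)
      -- The merged cycle contains both new edges and at least one edge from each old cycle.
      4≤L : 4 ≤ length L
      4≤L = ≤-trans (+-mono-≤ (≤-trans (∈-length i∈) (≤-reflexive (sym (length-map inj₁ cycle))))
                (s≤s (≤-trans (+-monoˡ-≤ 1 (≤-trans (∈-length j∈′) (≤-reflexive (sym (length-map inj₁ cycle′)))))
                              (≤-reflexive (sym (length-++ (map inj₁ cycle′)))))))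
              (≤-reflexive (sym (length-++ (map inj₁ cycle))))
      made : Outcome plan
      made = outcome plan (≤-trans 4≤L (length≤Σ weight⁺ L (λ _ → s≤s z≤n)) ∷ [])
      open Outcome made
      Σ≡2 : Σ[ weight⁺ ∘ inj₂ ] (𝒇′ ∷ 𝒇 ∷ []) ≡ 2
      Σ≡2 = cong₂ (λ a b → a + (b + 0)) (Plan.weight-before-old plan {𝒇′} refl) (Plan.weight-before-old plan {𝒇} f→)
      Ω≤ : Ω result ≤ Ω G + 2
      Ω≤ = ≤-trans bound (≤-reflexive (cong₂ _+_ (Plan.Ω-total plan) Σ≡2))
      gain : Gain made (length cycles) (g γ) (g γ) 0
      gain = +-monoˡ-≤ (8 * g γ) (begin
        Ω result + 0 + 4 * length cycles       ≤⟨ +-monoˡ-≤ (4 * length cycles) (+-monoˡ-≤ 0 Ω≤) ⟩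
        Ω G + 2 + 0 + 4 * length cycles        ≡⟨ cong (λ c → Ω G + 2 + 0 + 4 * c) (trans count (cong suc count′)) ⟩
        Ω G + 2 + 0 + 4 * (2 + length rest′)
          ≡⟨ solve 2 (λ o c → o :+ con 2 :+ con 0 :+ con 4 :* (con 2 :+ c) := o :+ con 6 :+ con 4 :* (con 1 :+ c)) refl (Ω G) (length rest′) ⟩
        Ω G + 6 + 4 * (1 + length rest′)       ∎)
        where
        open ≤-Reasoning
        open +-*-Solver using (solve; _:+_; _:*_; _:=_; con)

    -- The arc `a` runs from after `i` up to `j` and is closed by `𝒇`; the arc `b` runs from after
    -- `j` up to `i` and is closed by `𝒇′`.
    module Split (a b : List (Fin (m G))) (cycle≡ : cycle ≡ a ++ b) (j∈a : j ∈ a)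
                 (walkA : Walk (nxt G) i a j) (walkB : Walk (nxt G) j b i) where

      private
        covers : a ++ b ++ concat rest ↭ allFin (m G)
        covers = ↭-trans (↭-reflexive (trans (sym (++-assoc a b (concat rest))) (cong (_++ concat rest) (sym cycle≡)))) F.cover

        covers′ : b ++ a ++ concat rest ↭ allFin (m G)
        covers′ = ↭-trans (↭.shifts b a) covers

        uniq′ : Unique (a ++ b ++ concat rest)
        uniq′ = Unique-resp-↭ (↭-sym covers) (Unique.allFin⁺ _)

        b≢[] : b ≢ []
        b≢[] b≡[] = i≢j (sym (stays walkB b≡[]))
          where
          stays : ∀ {x y l} → Walk (nxt G) x l y → l ≡ [] → x ≡ y
          stays [] _ = refl

        i∈b : i ∈ b
        i∈b = last∈ walkB b≢[]
          where
          last∈ : ∀ {x y l} → Walk (nxt G) x l y → l ≢ [] → y ∈ l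
          last∈ []        l≢[] = contradiction refl l≢[]
          last∈ walk@(_ ∷ _) _ = walk-end walk

        i∉a : i ∉ a
        i∉a i∈a = Unique-++-disjoint a uniq′ i∈a (∈-++⁺ˡ i∈b)

        j∉b : j ∉ b
        j∉b j∈b = Unique-++-disjoint a uniq′ j∈a (∈-++⁺ˡ j∈b)

        offA : ∀ {x} → x ∈ a → x ≢ j → T (inj₁ x) ≡ inj₁ (nxt G x)
        offA x∈ x≢j = off (λ { refl → i∉a x∈ }) x≢j

        offB : ∀ {x} → x ∈ b → x ≢ i → T (inj₁ x) ≡ inj₁ (nxt G x)
        offB x∈ x≢i = off x≢i (λ { refl → j∉b x∈ })

        untouched : ∀ {x} → x ∈ concat rest → T (inj₁ x) ≡ inj₁ (nxt G x)
        untouched x∈ = off (λ { refl → Unique-++-disjoint b (Unique-++ʳ a uniq′) i∈b x∈ })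
                           (λ { refl → Unique-++-disjoint a uniq′ j∈a (∈-++⁺ʳ b x∈) })

        cycleA : Walk T (inj₂ 𝒇) (map inj₁ a ++ inj₂ 𝒇 ∷ []) (inj₂ 𝒇)
        cycleA = walk-map inj₁ walkA (∈⇒≢[] j∈a) (Unique-++ˡ a uniq′) offA f→ ++ʷ (at-j ∷ [])

        cycleB : Walk T (inj₂ 𝒇′) (map inj₁ b ++ inj₂ 𝒇′ ∷ []) (inj₂ 𝒇′)
        cycleB = walk-map inj₁ walkB b≢[] (Unique-++ˡ b (Unique-++ʳ a uniq′)) offB refl ++ʷ (at-i ∷ [])

        together : SameComp G v w
        together = walk⇒onCycle F.walk (subst (j ∈_) (sym cycle≡) (∈-++⁺ˡ j∈a))

      drop-b : Cheap {G} b (a ++ concat rest) → Response g₀ γ v w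
      drop-b (short , echo) = record
        { reply = _
        ; move = moveB together (Outcome.drops-cycle made (λ { (here ()) }) (λ { 𝒇 → inj₂ (here refl) ; 𝒇′ → inj₁ refl }) cycleB) refl
        ; grows = Outcome.grows made ; invariant = C.respond Σ≡3 short count stage }
        where
        module C = OneCell {v = v} {w} a b rest covers F.cells untouched echo (𝒇 ∷ []) ([] ∷ []) (𝒇 , here refl)
                     (cyclic (∈-++⁺ʳ (map inj₁ a) (here refl)) cycleA) j∈a at-j
        Σ≡3 : Σ[ Plan.weight⁺ C.plan ∘ inj₂ ] (𝒇 ∷ []) ≡ 3
        Σ≡3 = cong (_+ 0) (Plan.weight-before-old C.plan {𝒇} f→)
        made = C.made Σ≡3

      drop-a : Cheap {G} a (b ++ concat rest) → Response g₀ γ v w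
      drop-a (short , echo) = record
        { reply = _
        ; move = moveC together (Outcome.drops-cycle made (λ { (here ()) }) (λ { 𝒇 → inj₁ refl ; 𝒇′ → inj₂ (here refl) }) cycleA) refl
        ; grows = Outcome.grows made ; invariant = C.respond Σ≡3 short count stage }
        where
        module C = OneCell {v = v} {w} b a rest covers′ F.cells untouched echo (𝒇′ ∷ []) ([] ∷ []) (𝒇′ , here refl)
                     (cyclic (∈-++⁺ʳ (map inj₁ b) (here refl)) cycleB) i∈b at-i
        Σ≡3 : Σ[ Plan.weight⁺ C.plan ∘ inj₂ ] (𝒇′ ∷ []) ≡ 3
        Σ≡3 = cong (_+ 0) (Plan.weight-before-old C.plan {𝒇′} refl)
        made = C.made Σ≡3

      module Expensive (expA : ¬ Cheap {G} a (b ++ concat rest)) (expB : ¬ Cheap {G} b (a ++ concat rest)) where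

        private
          -- This is 4 c + 2 for c cycles: the split cycle contributes 3 for each of its arcs
          -- instead of 4.
          Ω≥ : 6 + 4 * length rest ≤ Ω G
          Ω≥ = begin
            6 + 4 * length rest
              ≡⟨ cong (6 +_) (*-comm 4 (length rest)) ⟩
            3 + 3 + length rest * 4
              ≤⟨ +-mono-≤ (+-mono-≤ 3≤a 3≤b) (Σ-concat (ω G) 4 rest (All.map Cell.heavy F.cells)) ⟩
            Σ[ ω G ] a + Σ[ ω G ] b + Σ[ ω G ] (concat rest)
              ≡⟨ trans (+-assoc (Σ[ ω G ] a) _ _) (trans (cong (Σ[ ω G ] a +_) (sym (Σ-++ (ω G) b (concat rest)))) (sym (Σ-++ (ω G) a _))) ⟩
            Σ[ ω G ] (a ++ b ++ concat rest)
              ≡⟨ Σ-↭ (ω G) covers ⟩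
            Ω G ∎
            where
            open ≤-Reasoning
            bonus≤ω : ∀ x → 1 + bonus (occ (χ G x) (labels G)) ≤ ω G x
            bonus≤ω x = s≤s (m≤m+n _ _)
            3≤a = arc-heavy {G} covers expA (ω G) bonus≤ω walkA (∈⇒≢[] j∈a) (Unique-++ˡ a uniq′) (λ _ _ → fold⇒2≤ω G)
            3≤b = arc-heavy {G} covers′ expB (ω G) bonus≤ω walkB b≢[] (Unique-++ˡ b (Unique-++ʳ a uniq′)) (λ _ _ → fold⇒2≤ω G)

          not-fresh : ¬ Fresh G (length cycles)
          not-fresh (_ , Ω≤4 , _) = contradiction (≤-trans (m≤m+n 6 _) (≤-trans Ω≥ Ω≤4)) (<⇒≱ {4} (s≤s (s≤s (s≤s (s≤s (s≤s z≤n))))))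

        finished : g γ ≡ 0 → 4 * g₀ + 6 ≤ 3 * valueD G
        finished g≡0 with stage
        ... | inj₂ (fresh , _) = contradiction fresh not-fresh
        -- `4 + 4 * length rest` is 4 c, which cancels against the cycle term of the margin.
        ... | inj₁ margin = *-cancelˡ-≤ 2 (+-cancelˡ-≤ (4 + 4 * length rest) _ _ (begin
          4 + 4 * length rest + 2 * (4 * g₀ + 6)
            ≡⟨ solve 2 (λ r g → con 4 :+ con 4 :* r :+ con 2 :* (con 4 :* g :+ con 6) := con 6 :+ con 4 :* r :+ con 10 :+ con 8 :* g) refl (length rest) g₀ ⟩
          6 + 4 * length rest + 10 + 8 * g₀
            ≤⟨ +-monoˡ-≤ (8 * g₀) (+-monoˡ-≤ 10 Ω≥) ⟩
          Ω G + 10 + 8 * g₀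
            ≤⟨ margin ⟩
          6 * valueD G + 4 * length cycles + 8 * g γ
            ≡⟨ cong₂ (λ c k → 6 * valueD G + 4 * c + 8 * k) count g≡0 ⟩
          6 * valueD G + 4 * suc (length rest) + 0
            ≡⟨ solve 2 (λ v r → con 6 :* v :+ con 4 :* (con 1 :+ r) :+ con 0 := con 4 :+ con 4 :* r :+ con 2 :* (con 3 :* v)) refl (valueD G) (length rest) ⟩
          4 + 4 * length rest + 2 * (3 * valueD G) ∎))
          where
          open ≤-Reasoning
          open +-*-Solver using (solve; _:+_; _:*_; _:=_; con)

        pay : ∀ n → g γ ≡ suc n → Response g₀ γ v w
        pay n g≡ = record
          { reply = record { D = Outcome.result made ; g = n }
          ; move = moveA together (subst (1 ≤_) (sym g≡) (s≤s z≤n)) (Outcome.keeps-all made refl (here refl) (there (here refl)))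
                         (cong (_∸ 1) (sym g≡))
          ; grows = Outcome.grows made
          ; invariant = advance made {g = g γ} {n} stage gain (λ fresh → contradiction fresh not-fresh) }
          where
          newA = map inj₁ a ++ inj₂ 𝒇 ∷ []
          newB = map inj₁ b ++ inj₂ 𝒇′ ∷ []
          plan : Plan G v w
          plan = record
            { new = newA ∷ newB ∷ [] ; arcs = a ++ b ; dropped = [] ; rest = rest ; news = 𝒇 ∷ 𝒇′ ∷ []
            ; newCycles = cyclic (∈-++⁺ʳ (map inj₁ a) (here refl)) cycleA ∷ cyclic (∈-++⁺ʳ (map inj₁ b) (here refl)) cycleB ∷ []
            ; newEdges = ↭-trans (↭-reflexive (trans (++-assoc (map inj₁ a) _ _)
                                    (cong (λ l → map inj₁ a ++ inj₂ 𝒇 ∷ l) (++-identityʳ newB))))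
                (↭-trans (↭.++⁺ˡ (map inj₁ a) (↭.shifts (inj₂ 𝒇 ∷ []) (map inj₁ b)))
                (↭-reflexive (trans (sym (++-assoc (map inj₁ a) (map inj₁ b) (inj₂ 𝒇 ∷ inj₂ 𝒇′ ∷ [])))
                                    (cong (_++ inj₂ 𝒇 ∷ inj₂ 𝒇′ ∷ []) (sym (map-++ inj₁ a b))))))
            ; old = ↭-trans (↭-reflexive (++-assoc a b (concat rest))) covers ; restCells = F.cells
            ; untouched = untouched
            ; news! = ((λ ()) ∷ []) ∷ [] ∷ [] ; someNew = 𝒇 , here refl ; echo = [] }
          open Plan plan using (weight⁺; bonus≤weight⁺; weight-untouched)
          heavyA : 4 ≤ Σ[ weight⁺ ] newA
          -- The arc weighs 3 even without a fold at its end `j`, and the closing new edge adds 1.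
          heavyA = ≤-trans (+-mono-≤ {3} {_} {1} (≤-trans (arc-heavy {G} covers expA (weight⁺ ∘ inj₁) bonus≤weight⁺ walkA (∈⇒≢[] j∈a) (Unique-++ˡ a uniq′)
                      (λ x∈ x≢j fold → ≤-trans (fold⇒2≤ω G fold) (weight-untouched (offA x∈ x≢j))))
                      (≤-reflexive (sym (Σ-map weight⁺ inj₁ a)))) (s≤s z≤n))
                    (≤-reflexive (sym (Σ-++ weight⁺ (map inj₁ a) (inj₂ 𝒇 ∷ []))))
          heavyB : 4 ≤ Σ[ weight⁺ ] newB
          heavyB = ≤-trans (+-mono-≤ {3} {_} {1} (≤-trans (arc-heavy {G} covers′ expB (weight⁺ ∘ inj₁) bonus≤weight⁺ walkB b≢[] (Unique-++ˡ b (Unique-++ʳ a uniq′))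
                      (λ x∈ x≢i fold → ≤-trans (fold⇒2≤ω G fold) (weight-untouched (offB x∈ x≢i))))
                      (≤-reflexive (sym (Σ-map weight⁺ inj₁ b)))) (s≤s z≤n))
                    (≤-reflexive (sym (Σ-++ weight⁺ (map inj₁ b) (inj₂ 𝒇′ ∷ []))))
          made : Outcome plan
          made = outcome plan (heavyA ∷ heavyB ∷ [])
          open Outcome made
          Σ≡2 : Σ[ weight⁺ ∘ inj₂ ] (𝒇 ∷ 𝒇′ ∷ []) ≡ 2
          Σ≡2 = cong₂ (λ a b → a + (b + 0)) (Plan.weight-before-old plan {𝒇} f→) (Plan.weight-before-old plan {𝒇′} refl)
          Ω≤ : Ω result ≤ Ω G + 2
          Ω≤ = ≤-trans bound (≤-reflexive (cong₂ _+_ (Plan.Ω-total plan) Σ≡2))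
          gain : Gain made (length cycles) (g γ) n 0
          -- The balance is exact: a unit of the counter costs 8 and the new edges 2, while the
          -- label earns 6 and the additional cycle 4.
          gain = begin
            Ω result + 0 + 4 * length cycles + 8 * g γ       ≤⟨ +-monoˡ-≤ (8 * g γ) (+-monoˡ-≤ (4 * length cycles) (+-monoˡ-≤ 0 Ω≤)) ⟩
            Ω G + 2 + 0 + 4 * length cycles + 8 * g γ        ≡⟨ cong₂ (λ c k → Ω G + 2 + 0 + 4 * c + 8 * k) count g≡ ⟩
            Ω G + 2 + 0 + 4 * suc (length rest) + 8 * suc n
              ≡⟨ solve 3 (λ o c n → o :+ con 2 :+ con 0 :+ con 4 :* (con 1 :+ c) :+ con 8 :* (con 1 :+ n)
                                    := o :+ con 6 :+ con 4 :* (con 2 :+ c) :+ con 8 :* n) refl (Ω G) (length rest) n ⟩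
            Ω G + 6 + 4 * (2 + length rest) + 8 * n          ∎
            where
            open ≤-Reasoning
            open +-*-Solver using (solve; _:+_; _:*_; _:=_; con)

      respond-split : Response g₀ γ v w ⊎ 4 * g₀ + 6 ≤ 3 * valueD G
      respond-split with cheap? {G} b (a ++ concat rest) | cheap? {G} a (b ++ concat rest)
      ... | yes cheap | _         = inj₁ (drop-b cheap)
      ... | no _      | yes cheap = inj₁ (drop-a cheap)
      ... | no expB   | no expA   = by-counter (g γ) refl
        where
        open Expensive expA expB
        by-counter : ∀ n → g γ ≡ n → Response g₀ γ v w ⊎ 4 * g₀ + 6 ≤ 3 * valueD G
        by-counter zero    g≡ = inj₂ (finished g≡)
        by-counter (suc n) g≡ = inj₁ (pay n g≡)

    respond-distinct : Response g₀ γ v w ⊎ 4 * g₀ + 6 ≤ 3 * valueD G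
    respond-distinct with DecMembership._∈?_ _≟_ j cycle
    ... | no j∉  = inj₁ (merge j∉)
    ... | yes j∈ with walk-split F.walk j∈
    ... | a , b , cycle≡ , j∈a , walkA , walkB = Split.respond-split a b cycle≡ j∈a walkA walkB

  respond : ∀ v w → Response g₀ γ v w ⊎ 4 * g₀ + 6 ≤ 3 * valueD G
  respond (real i) (real j) with i ≟ j
  ... | yes refl = inj₁ (respond-same i)
  ... | no i≢j   = Distinct.respond-distinct i≢j
  respond (real i) vγ = inj₁ (insert-pair i 𝒇′ 𝒇 (λ ()) (there (here refl)) (here refl) (λ ())
    (stepOld-at G i vγ) refl refl (stepOld-off G vγ))
  respond (real i) wγ = inj₁ (insert-pair i 𝒇′ 𝒇 (λ ()) (there (here refl)) (here refl) (λ ())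
    (stepOld-at G i wγ) refl refl (stepOld-off G wγ))
  respond vγ (real j) = inj₁ (insert-pair j 𝒇 𝒇′ (λ ()) (here refl) (there (here refl)) (λ ())
    (stepW-at G j) refl refl (stepW-off G))
  respond wγ (real j) = inj₁ (insert-pair j 𝒇 𝒇′ (λ ()) (here refl) (there (here refl)) (λ ())
    (stepW-at G j) refl refl (stepW-off G))
  respond vγ vγ = inj₁ (respond-dummies vγ vγ tt tt)
  respond vγ wγ = inj₁ (respond-dummies vγ wγ tt tt)
  respond wγ vγ = inj₁ (respond-dummies wγ vγ tt tt)
  respond wγ wγ = inj₁ (respond-dummies wγ wγ tt tt)

-- The first move and the final induction

-- Only dummy vertices are available, and every choice leads to a single cycle of weight at most 4
-- with one label, so the margin 6 holds as 4 + 6 against 6 + 4.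
first-response : ∀ g₀ v w → Response g₀ (initial g₀) v w
first-response g₀ v w = record
  { reply = _ ; move = move ; grows = grows
  ; invariant = invariant⁺ made (inj₂ ((folds , Ω≤ , count) , margin)) }
  where
  no-real : ∀ v → NoReal {0} v
  no-real vγ = tt
  no-real wγ = tt
  open Loops {initial g₀} {v} {w} (loops (initial g₀) [] [] ↭-refl v w (no-real v) (no-real w))
  folds : ∀ x → χ result (nxt result x) ≡ χ result x
  folds x = all-new (λ ()) _ _
  margin : Margin g₀ result g₀ (length (Plan.new plan) + length (Plan.rest plan)) 6
  margin = +-monoˡ-≤ (8 * g₀) (≤-trans (+-monoˡ-≤ 6 Ω≤)
    (+-mono-≤ {6} {6 * valueD result} {4} (*-monoʳ-≤ 6 (≤-trans (s≤s z≤n) grows)) (≤-reflexive (cong (4 *_) (sym count)))))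

-- Induction on `n`, a bound for the distance from the target, which shrinks because every reply
-- raises the value. By `older` the value exceeds that of all earlier positions, so no reply is
-- forbidden.
forces : ∀ g₀ n {hist γ} → (∀ {δ} → δ ∈ hist → value δ < value γ) → Invariant g₀ (D γ) (g γ) →
         4 * g₀ + 6 ≤ 3 * value γ + n → CutterForces (4 * g₀ + 6) hist γ
forces g₀ zero    older inv target = reached (≤-trans target (≤-reflexive (+-identityʳ _)))
forces g₀ (suc n) {hist} {γ} older inv target with 4 * g₀ + 6 ℕ.≤? 3 * value γ
... | yes done = reached done
... | no  ¬done = step λ v w → continue v w (respond g₀ γ inv v w)
  where
  continue : ∀ v w → Response g₀ γ v w ⊎ 4 * g₀ + 6 ≤ 3 * valueD (D γ) →
             ∃[ γ′ ] Move γ v w γ′ × ¬ Forbidden (γ ∷ hist) γ′ × CutterForces (4 * g₀ + 6) (γ ∷ hist) γ′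
  -- A reply is lacking only in a position that has already reached the target.
  continue v w (inj₂ done) = contradiction done ¬done
  continue v w (inj₁ r) = reply , move , increasing⇒allowed {γ′ = reply} older′ , forces g₀ n older′ invariant
    (≤-trans target (≤-trans (≤-reflexive (+-suc (3 * value γ) n))
      (+-monoˡ-≤ n (≤-trans (m≤n+m (1 + 3 * value γ) 2) (≤-trans (≤-reflexive (sym (*-suc 3 (value γ)))) (*-monoʳ-≤ 3 grows))))))
    where
    open Response r
    older′ : ∀ {δ} → δ ∈ γ ∷ hist → value δ < value reply
    older′ (here refl) = grows
    older′ (there δ∈)  = <-trans (older δ∈) grows

-- The target is 4/3 g₀ + 2 multiplied by 3. The empty position satisfies the margin of neither
-- stage, so the first reply is treated apart.
theorem5p5 : (g₀ : ℕ) → 1 ≤ g₀ → CutterForces (4 * g₀ + 6) [] (initial g₀)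
theorem5p5 g₀ _ = step λ v w → let open Response (first-response g₀ v w) in
  reply , move , increasing⇒allowed {γ′ = reply} (λ { (here refl) → grows }) ,
  -- The target itself serves as the bound for the distance from it.
  forces g₀ (4 * g₀ + 6) (λ { (here refl) → grows }) invariant (m≤n+m (4 * g₀ + 6) (3 * value reply))
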